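{- Let $d\ge1$, let $\kappa$ be a regular cardinal (possibly $\kappa=\omega$), and let $\gamma_1,\gamma_2$ be ordinals with $\gamma_1\equiv\omega^\omega$, $\gamma_2\equiv\omega^\omega$ and $\operatorname{cf}(\gamma_1)=\operatorname{cf}(\gamma_2)=\kappa$. Then for every $q<\omega$ and every $d$-colored ordinal $\mathfrak A$ of order type $\gamma_1$ there exists a $d$-colored ordinal $\mathfrak B$ of order type $\gamma_2$ such that $\mathfrak A\equiv_q\mathfrak B$.
   Context: A $d$-colored ordinal is a structure $\mathfrak A=(A,<,C_0,\dots,C_{d-1})$ where $(A,<)$ is an ordinal (well-order) and the unary predicates $C_i$ partition $A$. $\mathfrak A\equiv_q\mathfrak B$ means agreement on all first-order sentences of quantifier rank at most $q$. For an ordinal $\gamma$, $\gamma\equiv\omega^\omega$ means that $(\gamma,<)$ and $(\omega^\omega,<)$ are elementarily equivalent as linear orders; equivalently, $\gamma\ge\omega^\omega$ and the Cantor normal form of $\gamma$ contains no term with finite exponent. $\operatorname{cf}$ denotes cofinality. -}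

module Defs where

open import Axiom.ExcludedMiddle using (ExcludedMiddle)
open import Data.Empty.Polymorphic using (⊥)
open import Data.Fin.Base using (Fin)
open import Data.Nat.Base as ℕ using (ℕ; suc; _⊔_)
open import Data.Nat.Induction using (<-wellFounded)
import Data.Nat.Properties as ℕₚ
open import Data.Product using (Σ; Σ-syntax; ∃-syntax; ∃!; _×_; _,_)
open import Data.Sum.Base using (_⊎_)
open import Data.Vec.Base using (Vec; []; _∷_; lookup)
open import Data.Vec.Relation.Binary.Lex.Strict as Lex using (Lex-<)
open import Data.Vec.Relation.Binary.Pointwise.Inductive
  using (Pointwise-≡⇒≡; ≡⇒Pointwise-≡)
open import Function.Bundles using (_⇔_; _↔_)
open import Induction.WellFounded using (WellFounded; Acc; acc)
open import Level using (Level; 0ℓ; Setω) renaming (suc to lsuc; _⊔_ to _⊔ˡ_)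
open import Relation.Binary.Core using (Rel)
open import Relation.Binary.Definitions
  using (Transitive; Trichotomous; tri<; tri≈; tri>)
open import Relation.Binary.Morphism.Structures using (IsOrderIsomorphism)
open import Relation.Binary.PropositionalEquality
  using (_≡_; refl; sym; cong; isEquivalence)
open import Relation.Binary.Structures using (IsStrictTotalOrder)
open import Relation.Binary.Structures.Biased using (isStrictTotalOrderᶜ)
open import Relation.Nullary.Negation using (¬_)

private
  variable
    ℓ ℓ′ : Level

-- The mathematics is classical. Excluded middle for arbitrary (untruncated)
-- types also yields choice, so this single assumption stands for the ambient
-- set theory with choice.
Classical : Setω
Classical = ∀ a → ExcludedMiddle a

------------------------------------------------------------------------
-- Ordinals, considered up to order isomorphism

record Ordinal (ℓ : Level) : Set (lsuc ℓ) where
  infix 4 _<_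
  field
    Carrier            : Set ℓ
    _<_                : Rel Carrier ℓ
    isStrictTotalOrder : IsStrictTotalOrder _≡_ _<_
    wellFounded        : WellFounded _<_

open Ordinal using (Carrier)

infix 4 _≅_ _≼_

_≅_ : Ordinal ℓ → Ordinal ℓ′ → Set (ℓ ⊔ˡ ℓ′)
α ≅ β = Σ[ f ∈ (Carrier α → Carrier β) ]
          IsOrderIsomorphism _≡_ _≡_ (Ordinal._<_ α) (Ordinal._<_ β) f

StrictlyIncreasing : (α : Ordinal ℓ) (β : Ordinal ℓ′) →
                     (Carrier α → Carrier β) → Set (ℓ ⊔ˡ ℓ′)
StrictlyIncreasing α β f = ∀ {x y} → x <ᵅ y → f x <ᵝ f y
  where
  open Ordinal α using () renaming (_<_ to _<ᵅ_)
  open Ordinal β using () renaming (_<_ to _<ᵝ_)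

-- α ≼ β iff α is isomorphic to an initial segment of β.
_≼_ : Ordinal ℓ → Ordinal ℓ′ → Set (ℓ ⊔ˡ ℓ′)
α ≼ β = Σ[ f ∈ (Carrier α → Carrier β) ]
          StrictlyIncreasing α β f ×
          (∀ x {y} → Ordinal._<_ β y (f x) → ∃[ z ] f z ≡ y)

ω : Ordinal 0ℓ
ω = record
  { Carrier            = ℕ
  ; _<_                = ℕ._<_
  ; isStrictTotalOrder = ℕₚ.<-isStrictTotalOrder
  ; wellFounded        = <-wellFounded
  }

------------------------------------------------------------------------
-- Cofinality and regular cardinals

-- γ has a cofinal subset of order type δ.
HasCofinalSubset : (γ δ : Ordinal ℓ) → Set ℓ
HasCofinalSubset γ δ = Σ[ f ∈ (Carrier δ → Carrier γ) ]
                         StrictlyIncreasing δ γ f ×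
                         (∀ x → ∃[ i ] (x < f i ⊎ x ≡ f i))
  where open Ordinal γ using (_<_)

-- cf γ = κ: the least order type of a cofinal subset of γ is κ.
Cf_≡_ : (γ κ : Ordinal ℓ) → Set (lsuc ℓ)
Cf_≡_ {ℓ} γ κ = HasCofinalSubset γ κ ×
                ((δ : Ordinal ℓ) → HasCofinalSubset γ δ → κ ≼ δ)

-- Cardinals are initial ordinals.
IsCardinal : Ordinal ℓ → Set (lsuc ℓ)
IsCardinal {ℓ} κ = (δ : Ordinal ℓ) → Carrier δ ↔ Carrier κ → κ ≼ δ

record IsRegularCardinal (κ : Ordinal ℓ) : Set (lsuc ℓ) where
  field
    isCardinal : IsCardinal κ
    infinite   : ω ≼ κ
    regular    : Cf κ ≡ κ

------------------------------------------------------------------------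
-- First-order logic with equality, a binary relation and d unary
-- predicates

-- Formulas with at most n free variables, as de Bruijn indices.
data Formula (d : ℕ) : ℕ → Set where
  _≐_ _≺_         : ∀ {n} → Fin n → Fin n → Formula d n
  color           : ∀ {n} → Fin d → Fin n → Formula d n
  ⊥′              : ∀ {n} → Formula d n
  ¬′_             : ∀ {n} → Formula d n → Formula d n
  _∧′_ _∨′_ _⇒′_  : ∀ {n} → Formula d n → Formula d n → Formula d n
  ∀′_ ∃′_         : ∀ {n} → Formula d (suc n) → Formula d n

Sentence : ℕ → Set
Sentence d = Formula d 0

rank : ∀ {d n} → Formula d n → ℕ
rank (x ≐ y)     = 0
rank (x ≺ y)     = 0
rank (color i x) = 0
rank ⊥′          = 0
rank (¬′ φ)      = rank φ
rank (φ ∧′ ψ)    = rank φ ⊔ rank ψ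
rank (φ ∨′ ψ)    = rank φ ⊔ rank ψ
rank (φ ⇒′ ψ)    = rank φ ⊔ rank ψ
rank (∀′ φ)      = suc (rank φ)
rank (∃′ φ)      = suc (rank φ)

record Structure (d : ℕ) (ℓ : Level) : Set (lsuc ℓ) where
  field
    Carrier : Set ℓ
    _<_     : Rel Carrier ℓ
    C       : Fin d → Carrier → Set ℓ

module _ {d : ℕ} (𝔐 : Structure d ℓ) where
  open Structure 𝔐 using (_<_; C) renaming (Carrier to M)

  Satisfies : ∀ {n} → Vec M n → Formula d n → Set ℓ
  Satisfies ρ (x ≐ y)     = lookup ρ x ≡ lookup ρ y
  Satisfies ρ (x ≺ y)     = lookup ρ x < lookup ρ y
  Satisfies ρ (color i x) = C i (lookup ρ x)
  Satisfies ρ ⊥′          = ⊥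
  Satisfies ρ (¬′ φ)      = ¬ Satisfies ρ φ
  Satisfies ρ (φ ∧′ ψ)    = Satisfies ρ φ × Satisfies ρ ψ
  Satisfies ρ (φ ∨′ ψ)    = Satisfies ρ φ ⊎ Satisfies ρ ψ
  Satisfies ρ (φ ⇒′ ψ)    = Satisfies ρ φ → Satisfies ρ ψ
  Satisfies ρ (∀′ φ)      = ∀ a → Satisfies (a ∷ ρ) φ
  Satisfies ρ (∃′ φ)      = ∃[ a ] Satisfies (a ∷ ρ) φ

infix 4 _⊨_

_⊨_ : ∀ {d} → Structure d ℓ → Sentence d → Set ℓ
𝔐 ⊨ φ = Satisfies 𝔐 [] φ

ElementarilyEquivalent : ∀ {d} → Structure d ℓ → Structure d ℓ′ → Set (ℓ ⊔ˡ ℓ′)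
ElementarilyEquivalent {d = d} 𝔐 𝔑 = (φ : Sentence d) → 𝔐 ⊨ φ ⇔ 𝔑 ⊨ φ

EquivalentUpTo : ∀ {d} → ℕ → Structure d ℓ → Structure d ℓ′ → Set (ℓ ⊔ˡ ℓ′)
EquivalentUpTo {d = d} q 𝔐 𝔑 =
  (φ : Sentence d) → rank φ ℕ.≤ q → 𝔐 ⊨ φ ⇔ 𝔑 ⊨ φ

linearOrder : Ordinal ℓ → Structure 0 ℓ
linearOrder α = record
  { Carrier = Carrier α
  ; _<_     = Ordinal._<_ α
  ; C       = λ ()
  }

infix 4 _≡ᴸᴼ_

_≡ᴸᴼ_ : Ordinal ℓ → Ordinal ℓ′ → Set (ℓ ⊔ˡ ℓ′)
α ≡ᴸᴼ β = ElementarilyEquivalent (linearOrder α) (linearOrder β)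

------------------------------------------------------------------------
-- Colored ordinals

-- The classes of the partition are allowed to be empty.
record ColoredOrdinal (d : ℕ) (ℓ : Level) : Set (lsuc ℓ) where
  field
    ordinal   : Ordinal ℓ
    C         : Fin d → Carrier ordinal → Set ℓ
    partition : ∀ a → ∃! _≡_ (λ i → C i a)

  structure : Structure d ℓ
  structure = record
    { Carrier = Carrier ordinal
    ; _<_     = Ordinal._<_ ordinal
    ; C       = C
    }

OfOrderType : ∀ {d} → ColoredOrdinal d ℓ → Ordinal ℓ′ → Set (ℓ ⊔ˡ ℓ′)
OfOrderType 𝔄 γ = ColoredOrdinal.ordinal 𝔄 ≅ γ

infix 4 _≡[_]_

_≡[_]_ : ∀ {d} → ColoredOrdinal d ℓ → ℕ → ColoredOrdinal d ℓ′ → Set (ℓ ⊔ˡ ℓ′)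
𝔄 ≡[ q ] 𝔅 = EquivalentUpTo q (ColoredOrdinal.structure 𝔄)
                              (ColoredOrdinal.structure 𝔅)

------------------------------------------------------------------------
-- The ordinal ω^ω

-- Cantor normal forms of the ordinals below ω^ω: (0 , []) stands for 0,
-- and (n + 1 , a ∷ cₙ₋₁ ∷ … ∷ c₀ ∷ []) for
-- ω^n · (a + 1) + ω^(n-1) · cₙ₋₁ + … + ω^0 · c₀.
CNF : Set
CNF = Σ ℕ (Vec ℕ)

infix 4 _<ᶜ_

data _<ᶜ_ : Rel CNF 0ℓ where
  degree : ∀ {m n} {u : Vec ℕ m} {v : Vec ℕ n} → m ℕ.< n → (m , u) <ᶜ (n , v)
  coeffs : ∀ {n} {u v : Vec ℕ n} → Lex-< _≡_ ℕ._<_ u v → (n , u) <ᶜ (n , v)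

private
  lex-trans : ∀ {n} → Transitive (Lex-< _≡_ ℕ._<_ {n} {n})
  lex-trans = IsStrictTotalOrder.trans (Lex.<-isStrictTotalOrder ℕₚ.<-isStrictTotalOrder)

  <ᶜ-trans : Transitive _<ᶜ_
  <ᶜ-trans (degree p) (degree q) = degree (ℕₚ.<-trans p q)
  <ᶜ-trans (degree p) (coeffs q) = degree p
  <ᶜ-trans (coeffs p) (degree q) = degree q
  <ᶜ-trans (coeffs p) (coeffs q) = coeffs (lex-trans p q)

  degree-≮ : ∀ {m n} {u : Vec ℕ m} {v : Vec ℕ n} → m ℕ.< n → ¬ (n , v) <ᶜ (m , u)
  degree-≮ p (degree q) = ℕₚ.<-asym p q
  degree-≮ p (coeffs q) = ℕₚ.<-irrefl refl p

  coeffs-≮ : ∀ {n} {u v : Vec ℕ n} → ¬ Lex-< _≡_ ℕ._<_ u v → ¬ (n , u) <ᶜ (n , v)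
  coeffs-≮ u≮v (degree n<n) = ℕₚ.<-irrefl refl n<n
  coeffs-≮ u≮v (coeffs u<v) = u≮v u<v

  <ᶜ-cmp : Trichotomous _≡_ _<ᶜ_
  <ᶜ-cmp (m , u) (n , v) with ℕₚ.<-cmp m n
  ... | tri< m<n m≢n _ = tri< (degree m<n) (λ { refl → m≢n refl }) (degree-≮ m<n)
  ... | tri> _ m≢n n<m = tri> (degree-≮ n<m) (λ { refl → m≢n refl }) (degree n<m)
  ... | tri≈ _ refl _ with Lex.<-cmp sym ℕₚ.<-cmp u v
  ...   | tri< u<v u≢v v≮u =
          tri< (coeffs u<v) (λ { refl → u≢v (≡⇒Pointwise-≡ refl) }) (coeffs-≮ v≮u)
  ...   | tri≈ u≮v u≡v v≮u =
          tri≈ (coeffs-≮ u≮v) (cong (_ ,_) (Pointwise-≡⇒≡ u≡v)) (coeffs-≮ v≮u)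
  ...   | tri> u≮v u≢v v<u =
          tri> (coeffs-≮ u≮v) (λ { refl → u≢v (≡⇒Pointwise-≡ refl) }) (coeffs v<u)

  <ᶜ-wellFounded : WellFounded _<ᶜ_
  <ᶜ-wellFounded (n , v) = accessible (<-wellFounded n) (lex-wellFounded v)
    where
    lex-wellFounded : ∀ {n} → WellFounded (Lex-< _≡_ ℕ._<_ {n} {n})
    lex-wellFounded = Lex.<-wellFounded (λ { refl q → q }) (λ { refl p → p }) <-wellFounded

    mutual
      accessible : ∀ {n v} → Acc ℕ._<_ n → Acc (Lex-< _≡_ ℕ._<_) v → Acc _<ᶜ_ (n , v)
      accessible accⁿ accᵛ = acc (below accⁿ accᵛ)

      below : ∀ {n v y} → Acc ℕ._<_ n → Acc (Lex-< _≡_ ℕ._<_) v →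
              y <ᶜ (n , v) → Acc _<ᶜ_ y
      below (acc rs) _        (degree {u = u} m<n) = accessible (rs m<n) (lex-wellFounded u)
      below accⁿ     (acc rs) (coeffs u<v)         = accessible accⁿ (rs u<v)

ω^ω : Ordinal 0ℓ
ω^ω = record
  { Carrier            = CNF
  ; _<_                = _<ᶜ_
  ; isStrictTotalOrder = isStrictTotalOrderᶜ record
      { isEquivalence = isEquivalence
      ; trans         = <ᶜ-trans
      ; compare       = <ᶜ-cmp
      }
  ; wellFounded        = <ᶜ-wellFounded
  }

{-# OPTIONS --safe #-}

-- The rank-q types of intervals of colored ordinals form a finite semigroup.
-- By an additive Ramsey argument, valid for every cofinality, an interval
-- without last element has type s + e · ω for an idempotent e; inductively
-- every type is realized below ω^ω. Inside an interval of length ω^k, k large,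
-- Ramsey intervals can be nested so often that the pigeonhole principle gives
-- e = e · ω + z. Then w = z + e · ω satisfies w = w · ω, so an interval whose
-- type ends in e · ω = e · ω + w has the type of a coloring of every nonzero
-- multiple of ω^n, for one fixed n. As multiples of ω^n are first-order
-- definable, they are cofinal in γ₁ and γ₂. Cutting γ₁ continuously into κ
-- intervals of such stretchable types and γ₂ into κ intervals ending in
-- multiples of ω^n, one copies the coloring interval by interval.

module Submission where

open import Defs
open import Data.Bool.Properties using (T-irrelevant)
open import Data.Empty.Polymorphic using (⊥)
open import Data.Fin.Base as Fin using (Fin; zero; suc; toℕ; combine; funToFin; finToFun)
open import Data.Fin.Properties using (combine-injective; finToFun-funToFin; pigeonhole; toℕ<n)
open import Data.Nat.Base as ℕ using (ℕ; zero; suc)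
import Data.Nat.Properties as ℕₚ
open import Data.Product using (Σ-syntax; ∃-syntax; _×_; _,_; proj₁; proj₂)
open import Data.Sum.Base using (_⊎_; inj₁; inj₂)
open import Data.Unit.Polymorphic using (⊤; tt)
open import Data.Vec.Base using (Vec; []; _∷_; lookup; replicate; head)
import Data.Vec.Relation.Binary.Lex.Strict as Lex
open import Data.Vec.Relation.Binary.Lex.Strict using (Lex-<)
open import Function.Base using (_∘_; id; const; _on_)
open import Function.Bundles using (mk⇔; module Equivalence)
open import Induction.WellFounded using (Acc; acc; module FixPoint; module All)
open import Level using (Level; Lift; lift; lower) renaming (suc to lsuc)
import Relation.Binary.Construct.On as On
open import Relation.Binary.Core using (Rel)
open import Relation.Binary.Definitions using (Tri; tri<; tri≈; tri>; Trichotomous)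
open import Relation.Binary.Morphism.Structures using (IsOrderIsomorphism)
open import Relation.Binary.PropositionalEquality
  using (_≡_; refl; sym; trans; cong; cong₂; subst; isEquivalence)
open import Relation.Binary.Structures using (IsStrictTotalOrder)
open import Relation.Binary.Structures.Biased using (isStrictTotalOrderᶜ)
open import Relation.Nullary.Decidable using (Dec; yes; no; True; toWitness; fromWitness)
open import Relation.Nullary.Negation using (¬_; contradiction)
open import Relation.Unary using (Pred)
open Ordinal using (Carrier)

-- The obstacle is that corresponding places of `γ₁` and `γ₂` may have different cofinalities. The
-- type `e · ω` of a homogeneous tail does not depend on the cofinality of its end; but to realize
-- it on a prescribed interval, transfinitely many blocks may have to be laid end to end, and a
-- block that starts at a limit is preceded by `e · ω`, not by `e`. The equation `e = e · ω + z`
-- makes successor and limit stages look alike. Only right ends have to be controlled: if `b` is a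
-- multiple of `ω^n`, then for every `a < b` the order type of `[a, b)` is a nonzero multiple of
-- `ω^n`. So the left ends of the intervals, which continuity forces to be suprema at limit stages,
-- may be arbitrary. The finiteness of the set of types enters twice: `n` is the largest of the
-- exponents attached to the single types, and one more nested Ramsey interval than there are types
-- is needed for the pigeonhole.

-- Multiples of `ω^n`: definability, and cofinality in `ω^ω`

-- For x > 0: x is a multiple of ω^n.
Multiple : ∀ {a} {A : Set a} → Rel A a → ℕ → Pred A a
Multiple _<_ zero    x = ⊤
Multiple _<_ (suc n) x = ∀ z → z < x → ∃[ y ] (z < y × y < x × Multiple _<_ n y)

MultiplesCofinal : ∀ {a} → Ordinal a → Set a
MultiplesCofinal α = ∀ n x → ∃[ y ] (Ordinal._<_ α x y × Multiple (Ordinal._<_ α) n y)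

≅-refl : ∀ {ℓ} (γ : Ordinal ℓ) → γ ≅ γ
≅-refl γ = id , record
  { isOrderMonomorphism = record
    { isOrderHomomorphism = record { cong = id ; mono = id }
    ; injective           = id
    ; cancel              = id
    }
  ; surjective = λ y → y , id
  }

multiple : ℕ → ∀ {k} → Fin k → Formula 0 k
multiple zero    x = ¬′ ⊥′
multiple (suc n) x =
  ∀′ ((zero ≺ suc x) ⇒′ (∃′ ((suc zero ≺ zero) ∧′ ((zero ≺ suc (suc x)) ∧′ multiple n zero))))

module _ {a} (α : Ordinal a) where
  private
    𝔐 = linearOrder α

  multiple-sound : ∀ n {k} (x : Fin k) ρ → Satisfies 𝔐 ρ (multiple n x) →
                   Multiple (Ordinal._<_ α) n (lookup ρ x)
  multiple-sound zero    x ρ _ = tt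
  multiple-sound (suc n) x ρ s z z<x with s z z<x
  ... | y , z<y , y<x , s′ = y , z<y , y<x , multiple-sound n zero (y ∷ z ∷ ρ) s′

  multiple-complete : ∀ n {k} (x : Fin k) ρ → Multiple (Ordinal._<_ α) n (lookup ρ x) →
                      Satisfies 𝔐 ρ (multiple n x)
  multiple-complete zero    x ρ _ ()
  multiple-complete (suc n) x ρ D z z<x with D z z<x
  ... | y , z<y , y<x , D′ = y , z<y , y<x , multiple-complete n zero (y ∷ z ∷ ρ) D′

-- For each `n` the property is a single sentence, whose rank grows with `n`; this is where full
-- elementary equivalence with `ω^ω` enters.
multiplesCofinal-resp : ∀ {a b} (α : Ordinal a) (β : Ordinal b) → α ≡ᴸᴼ β →
                        MultiplesCofinal β → MultiplesCofinal α
multiplesCofinal-resp α β α≡β cofinal n x with Equivalence.from (α≡β sentence) holds x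
  where
  sentence : Sentence 0
  sentence = ∀′ (∃′ ((suc zero ≺ zero) ∧′ multiple n zero))
  holds : linearOrder β ⊨ sentence
  holds x with cofinal n x
  ... | y , x<y , D = y , x<y , multiple-complete β n zero (y ∷ x ∷ []) D
... | y , x<y , s = y , x<y , multiple-sound α n zero (y ∷ x ∷ []) s

-- In a normal form `(suc m , a ∷ v)` the leading coefficient is `a + 1`, hence nonzero.
-- Divisibility by `ω^n` therefore restricts `v` alone: it has to end in `n` zeros.
data LowZeros (n : ℕ) : ∀ {m} → Vec ℕ m → Set where
  zeros : LowZeros n (replicate n 0)
  _∷_   : ∀ {m} {v : Vec ℕ m} a → LowZeros n v → LowZeros n (a ∷ v)

replicate-lowZeros : ∀ {n m} → n ℕ.≤ m → LowZeros n (replicate m 0)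
replicate-lowZeros {n} n≤m = go (ℕₚ.≤⇒≤′ n≤m)
  where
  go : ∀ {m} → n ℕ.≤′ m → LowZeros n (replicate m 0)
  go ℕ.≤′-refl       = zeros
  go (ℕ.≤′-step n≤m) = 0 ∷ go n≤m

lowZeros-length : ∀ {n m} {v : Vec ℕ m} → LowZeros n v → n ℕ.≤ m
lowZeros-length zeros   = ℕₚ.≤-refl
lowZeros-length (_ ∷ z) = ℕₚ.m≤n⇒m≤1+n (lowZeros-length z)

≮zeros : ∀ {n} {u : Vec ℕ n} → ¬ Lex-< _≡_ ℕ._<_ u (replicate n 0)
≮zeros {suc n} (Lex.this () _)
≮zeros {suc n} (Lex.next _ u<0) = ≮zeros u<0

bump : ∀ {m} (u : Vec ℕ (suc m)) → Lex-< _≡_ ℕ._<_ u (suc (head u) ∷ replicate m 0)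
bump (_ ∷ _) = Lex.this (ℕₚ.n<1+n _) refl

-- The new vector copies `u` through the first place where `u` is smaller, adds one to the next
-- entry of `u`, and continues with zeros. The first difference lies before the low zeros, since
-- nothing is below a vector of zeros, so the raised entry costs at most one of them.
between : ∀ {n m} (u : Vec ℕ (suc m)) a {v : Vec ℕ m} → LowZeros (suc n) v → Lex-< _≡_ ℕ._<_ u (a ∷ v) →
          ∃[ b ] Σ[ w ∈ Vec ℕ m ] (Lex-< _≡_ ℕ._<_ u (b ∷ w) × Lex-< _≡_ ℕ._<_ (b ∷ w) (a ∷ v) × LowZeros n w)
between {n} {zero}  (x ∷ u) a z (Lex.this x<a refl) = contradiction (lowZeros-length z) λ ()
between {n} {suc m} (x ∷ u) a z (Lex.this x<a refl) = x , suc (head u) ∷ replicate m 0 ,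
  Lex.next refl (bump u) , Lex.this x<a refl , _ ∷ replicate-lowZeros (ℕₚ.≤-pred (lowZeros-length z))
between (x ∷ u) a zeros   (Lex.next refl u<v) = contradiction u<v ≮zeros
between (x ∷ u) a (b ∷ z) (Lex.next refl u<v) with between u b z u<v
... | b′ , w , u<w , w<v , z′ = x , b′ ∷ w , Lex.next refl u<w , Lex.next refl w<v , b′ ∷ z′

lowZeros-multiple : ∀ n {m} a {v : Vec ℕ m} → LowZeros n v → Multiple _<ᶜ_ n (suc m , a ∷ v)
lowZeros-multiple zero    a z = tt
lowZeros-multiple (suc n) a z (_ , u) (coeffs u<v) with between u a z u<v
... | b , w , u<w , w<v , z′ = _ , coeffs u<w , coeffs w<v , lowZeros-multiple n b z′
lowZeros-multiple (suc n) {zero}  a z (k , u) (degree _) = contradiction (lowZeros-length z) λ ()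
lowZeros-multiple (suc n) {suc m} a z (k , u) (degree k<) with ℕₚ.<-cmp k (suc m)
... | tri< k<m _ _ = (suc m , replicate (suc m) 0) , degree k<m , degree (ℕₚ.n<1+n _) ,
  lowZeros-multiple n 0 (replicate-lowZeros (ℕₚ.≤-pred (lowZeros-length z)))
... | tri≈ _ refl _ = (suc m , suc (head u) ∷ replicate m 0) , coeffs (bump u) , degree (ℕₚ.n<1+n _) ,
  lowZeros-multiple n _ (replicate-lowZeros (ℕₚ.≤-pred (lowZeros-length z)))
... | tri> _ _ m<k = contradiction (ℕₚ.≤-pred k<) (ℕₚ.<⇒≱ m<k)

ω^ω-multiplesCofinal : MultiplesCofinal ω^ω
ω^ω-multiplesCofinal n (m , v) = (suc (m ℕ.+ n) , replicate (suc (m ℕ.+ n)) 0) ,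
  degree (ℕ.s≤s (ℕₚ.m≤m+n m n)) , lowZeros-multiple n 0 (replicate-lowZeros (ℕₚ.m≤n+m n m))


-- Classical preliminaries and rank-`q` types

module Types (em : Classical) (ℓ : Level) (d : ℕ) where

  byContradiction : ∀ {p} {P : Set p} → ¬ ¬ P → P
  byContradiction {p} {P} ¬¬p with em p {P}
  ... | yes x = x
  ... | no ¬x = contradiction ¬x ¬¬p

  ¬∀⇒∃¬ : ∀ {a p} {A : Set a} {P : A → Set p} → ¬ (∀ x → P x) → ∃[ x ] ¬ P x
  ¬∀⇒∃¬ ¬∀ = byContradiction λ ¬∃ → ¬∀ λ x → byContradiction λ ¬px → ¬∃ (x , ¬px)

  abstract
    dependent-choice : ∀ {a r} {A : Set a} {R : A → A → Set r} (x : A) → (∀ x → ∃[ y ] R x y) →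
                       Σ[ f ∈ (ℕ → A) ] (f 0 ≡ x × ∀ i → R (f i) (f (suc i)))
    dependent-choice {A = A} x next = f , refl , λ i → proj₂ (next (f i))
      where
      f : ℕ → A
      f zero    = x
      f (suc i) = proj₁ (next (f i))

  module Order (γ : Ordinal ℓ) where
    open Ordinal γ public using (_<_)
    open IsStrictTotalOrder (Ordinal.isStrictTotalOrder γ) public
      using (compare; _<?_) renaming (trans to <-trans; irrefl to <-irrefl; asym to <-asym)

    infix 4 _≤_
    _≤_ : Carrier γ → Carrier γ → Set ℓ
    x ≤ y = ¬ (y < x)

    ≤-refl : ∀ {x} → x ≤ x
    ≤-refl = <-irrefl refl

    <⇒≤ : ∀ {x y} → x < y → x ≤ y
    <⇒≤ = <-asym

    ≤⇒<⊎≡ : ∀ {x y} → x ≤ y → x < y ⊎ x ≡ y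
    ≤⇒<⊎≡ {x} {y} x≤y with compare x y
    ... | tri< x<y _ _ = inj₁ x<y
    ... | tri≈ _ x≡y _ = inj₂ x≡y
    ... | tri> _ _ y<x = contradiction y<x x≤y

    ≤-<-trans : ∀ {x y z} → x ≤ y → y < z → x < z
    ≤-<-trans x≤y y<z with ≤⇒<⊎≡ x≤y
    ... | inj₁ x<y  = <-trans x<y y<z
    ... | inj₂ refl = y<z

    <-≤-trans : ∀ {x y z} → x < y → y ≤ z → x < z
    <-≤-trans x<y y≤z with ≤⇒<⊎≡ y≤z
    ... | inj₁ y<z  = <-trans x<y y<z
    ... | inj₂ refl = x<y

    ≤-trans : ∀ {x y z} → x ≤ y → y ≤ z → x ≤ z
    ≤-trans x≤y y≤z z<x = y≤z (<-≤-trans z<x x≤y)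

    ≤-antisym : ∀ {x y} → x ≤ y → y ≤ x → x ≡ y
    ≤-antisym x≤y y≤x with ≤⇒<⊎≡ x≤y
    ... | inj₁ x<y = contradiction x<y y≤x
    ... | inj₂ x≡y = x≡y

    <-≤-connex : ∀ x y → x < y ⊎ y ≤ x
    <-≤-connex x y with x <? y
    ... | yes x<y = inj₁ x<y
    ... | no  x≮y = inj₂ x≮y

    upperBound₂ : ∀ {b} x y → x < b → y < b → ∃[ z ] (z < b × x ≤ z × y ≤ z)
    upperBound₂ x y x<b y<b with <-≤-connex x y
    ... | inj₁ x<y = y , y<b , <⇒≤ x<y , ≤-refl
    ... | inj₂ y≤x = x , x<b , ≤-refl , y≤x

    least : ∀ {p} (P : Pred (Carrier γ) p) → ∃[ x ] P x → ∃[ m ] (P m × ∀ x → P x → m ≤ x)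
    least P (x , px) = go x px (Ordinal.wellFounded γ x)
      where
      go : ∀ x → P x → Acc _<_ x → ∃[ m ] (P m × ∀ x → P x → m ≤ x)
      go x px (acc rs) with em _ {∃[ y ] (y < x × P y)}
      ... | yes (y , y<x , py) = go y py (rs y<x)
      ... | no  none           = x , px , λ y py y<x → none (y , y<x , py)

    wf-induction : ∀ {p} (P : Pred (Carrier γ) p) →
                   (∀ x → (∀ y → y < x → P y) → P x) → ∀ x → P x
    wf-induction P step x = go x (Ordinal.wellFounded γ x)
      where
      go : ∀ x → Acc _<_ x → P x
      go x (acc rs) = step x (λ y y<x → go y (rs y<x))

  Coloring : Ordinal ℓ → Set ℓ
  Coloring γ = Carrier γ → Fin d

  Below Above : (γ : Ordinal ℓ) → Pred (Carrier γ) ℓ → Carrier γ → Pred (Carrier γ) ℓ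
  Below γ U a x = U x × Ordinal._<_ γ x a
  Above γ U a x = U x × Ordinal._<_ γ a x

  -- Codes of rank-q types: a type of rank q + 1 is a set of triples
  -- (type of the part below a, color of a, type of the part above a).
  #types : ℕ → ℕ
  #types zero    = 1
  #types (suc q) = 2 ℕ.^ (#types q ℕ.* (d ℕ.* #types q))

  Type : ℕ → Set
  Type q = Fin (#types q)

  private
    decToFin : ∀ {p} {P : Set p} → Dec P → Fin 2
    decToFin (yes _) = suc zero
    decToFin (no _)  = zero

    decToFin-cong : ∀ {p p′} {P : Set p} {P′ : Set p′} (P? : Dec P) (P′? : Dec P′) →
                    (P → P′) → (P′ → P) → decToFin P? ≡ decToFin P′?
    decToFin-cong (yes _) (yes _)  f g = refl
    decToFin-cong (no _)  (no _)   f g = refl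
    decToFin-cong (yes p) (no ¬p′) f g = contradiction (f p) ¬p′
    decToFin-cong (no ¬p) (yes p′) f g = contradiction (g p′) ¬p

    decToFin-transport : ∀ {p p′} {P : Set p} {P′ : Set p′} (P? : Dec P) (P′? : Dec P′) →
                         decToFin P? ≡ decToFin P′? → P → P′
    decToFin-transport _       (yes p′) eq p = p′
    decToFin-transport (yes _) (no _)   () p
    decToFin-transport (no ¬p) (no _)   eq p = contradiction p ¬p

    funToFin-cong : ∀ {m n} {f g : Fin m → Fin n} → (∀ i → f i ≡ g i) → funToFin f ≡ funToFin g
    funToFin-cong {zero}  f≗g = refl
    funToFin-cong {suc m} f≗g = cong₂ combine (f≗g zero) (funToFin-cong (f≗g ∘ suc))

  abstract
    -- Membership is decided by `em`. Coding types in `Fin` turns their equality, even across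
    -- different ordinals, into `≡` and makes `pigeonhole` applicable.
    subset : ∀ {n} → (Fin n → Set ℓ) → Fin (2 ℕ.^ n)
    subset P = funToFin (λ k → decToFin (em ℓ {P k}))

    subset-cong : ∀ {n} {P Q : Fin n → Set ℓ} →
                  (∀ k → P k → Q k) → (∀ k → Q k → P k) → subset P ≡ subset Q
    subset-cong P⊆Q Q⊆P = funToFin-cong λ k → decToFin-cong (em ℓ) (em ℓ) (P⊆Q k) (Q⊆P k)

    subset-injective : ∀ {n} {P Q : Fin n → Set ℓ} → subset P ≡ subset Q → ∀ k → P k → Q k
    subset-injective {n} {P} {Q} eq k = decToFin-transport (em ℓ) (em ℓ)
      (trans (sym (finToFun-funToFin _ k))
        (trans (cong (λ t → finToFun {2} {n} t k) eq) (finToFun-funToFin _ k)))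

    triple : ∀ {m n} → Fin m → Fin n → Fin m → Fin (m ℕ.* (n ℕ.* m))
    triple l i r = combine l (combine i r)

    triple-injective : ∀ {m n} {l l′ : Fin m} {i i′ : Fin n} {r r′ : Fin m} →
                       triple l i r ≡ triple l′ i′ r′ → l ≡ l′ × i ≡ i′ × r ≡ r′
    triple-injective {l = l} {l′} {i} {i′} {r} {r′} eq =
      let (eqˡ , eq′) = combine-injective l (combine i r) l′ (combine i′ r′) eq
          (eqⁱ , eqʳ) = combine-injective i r i′ r′ eq′
      in eqˡ , eqⁱ , eqʳ

  -- Types are relativized to a predicate `U` instead of a suborder, so that passing to the part
  -- below or above a point keeps the carrier.
  tp : ∀ q (γ : Ordinal ℓ) → Coloring γ → Pred (Carrier γ) ℓ → Type q
  Occurs : ∀ q (γ : Ordinal ℓ) → Coloring γ → Pred (Carrier γ) ℓ →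
           Fin (#types q ℕ.* (d ℕ.* #types q)) → Set ℓ

  tp zero    γ c U = zero
  tp (suc q) γ c U = subset (Occurs q γ c U)

  Occurs q γ c U k = ∃[ a ] (U a × triple (tp q γ c (Below γ U a)) (c a) (tp q γ c (Above γ U a)) ≡ k)

  record Match q (γ : Ordinal ℓ) (c : Coloring γ) (U : Pred (Carrier γ) ℓ)
                 (γ′ : Ordinal ℓ) (c′ : Coloring γ′) (V : Pred (Carrier γ′) ℓ)
                 (a : Carrier γ) (b : Carrier γ′) : Set ℓ where
    constructor match
    field
      inside : V b
      below  : tp q γ c (Below γ U a) ≡ tp q γ′ c′ (Below γ′ V b)
      colors : c a ≡ c′ b
      above  : tp q γ c (Above γ U a) ≡ tp q γ′ c′ (Above γ′ V b)

  tp-forth : ∀ q (γ γ′ : Ordinal ℓ) {c c′ U V} → tp (suc q) γ c U ≡ tp (suc q) γ′ c′ V →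
             ∀ a → U a → ∃[ b ] Match q γ c U γ′ c′ V a b
  tp-forth q γ γ′ eq a a∈U with subset-injective eq _ (a , a∈U , refl)
  ... | b , b∈V , eq′ with triple-injective eq′
  ... | eqˡ , eqᶜ , eqʳ = b , match b∈V (sym eqˡ) (sym eqᶜ) (sym eqʳ)

  tp-ext : ∀ q (γ γ′ : Ordinal ℓ) {c c′ U V} →
           (∀ a → U a → ∃[ b ] Match q γ c U γ′ c′ V a b) →
           (∀ b → V b → ∃[ a ] Match q γ′ c′ V γ c U b a) →
           tp (suc q) γ c U ≡ tp (suc q) γ′ c′ V
  tp-ext q γ γ′ forth back = subset-cong (half γ γ′ forth) (half γ′ γ back)
    where
    half : ∀ γ γ′ {c c′ U V} → (∀ a → U a → ∃[ b ] Match q γ c U γ′ c′ V a b) →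
           ∀ k → Occurs q γ c U k → Occurs q γ′ c′ V k
    half γ γ′ forth k (a , a∈U , refl) with forth a a∈U
    ... | b , match b∈V eqˡ eqᶜ eqʳ = b , b∈V , triple-cong (sym eqˡ) (sym eqᶜ) (sym eqʳ)
      where
      triple-cong : ∀ {m n} {l l′ : Fin m} {i i′ : Fin n} {r r′ : Fin m} →
                    l ≡ l′ → i ≡ i′ → r ≡ r′ → triple l i r ≡ triple l′ i′ r′
      triple-cong refl refl refl = refl

  tp-down : ∀ q (γ γ′ : Ordinal ℓ) {c c′ U V} → tp (suc q) γ c U ≡ tp (suc q) γ′ c′ V →
            tp q γ c U ≡ tp q γ′ c′ V
  tp-down zero    γ γ′ eq = refl
  tp-down (suc q) γ γ′ eq = tp-ext q γ γ′ (half γ γ′ eq) (half γ′ γ (sym eq))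
    where
    half : ∀ γ γ′ {c c′ U V} → tp (suc (suc q)) γ c U ≡ tp (suc (suc q)) γ′ c′ V →
           ∀ a → U a → ∃[ b ] Match q γ c U γ′ c′ V a b
    half γ γ′ eq a a∈U with tp-forth (suc q) γ γ′ eq a a∈U
    ... | b , match b∈V eqˡ eqᶜ eqʳ = b , match b∈V (tp-down q γ γ′ eqˡ) eqᶜ (tp-down q γ γ′ eqʳ)

  record Embeds (γ : Ordinal ℓ) (c : Coloring γ) (U : Pred (Carrier γ) ℓ)
                (γ′ : Ordinal ℓ) (c′ : Coloring γ′) (V : Pred (Carrier γ′) ℓ)
                (f : Carrier γ → Carrier γ′) : Set ℓ where
    field
      into  : ∀ x → U x → V (f x)
      onto  : ∀ y → V y → ∃[ x ] (U x × f x ≡ y)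
      mono  : ∀ x x′ → U x → U x′ → Ordinal._<_ γ x x′ → Ordinal._<_ γ′ (f x) (f x′)
      colors : ∀ x → U x → c x ≡ c′ (f x)

  module _ {γ γ′ : Ordinal ℓ} {c : Coloring γ} {c′ : Coloring γ′} {f : Carrier γ → Carrier γ′} where
    private
      module O = Order γ
      module O′ = Order γ′

    cancel : ∀ {U V} → Embeds γ c U γ′ c′ V f → ∀ {x x′} → U x → U x′ → f x O′.< f x′ → x O.< x′
    cancel E {x} {x′} ux ux′ fx<fx′ with O.compare x x′
    ... | tri< x<x′ _ _ = x<x′
    ... | tri≈ _ refl _ = contradiction fx<fx′ (O′.<-irrefl refl)
    ... | tri> _ _ x′<x = contradiction (Embeds.mono E _ _ ux′ ux x′<x) (O′.<-asym fx<fx′)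

    embeds-below : ∀ {U V} → Embeds γ c U γ′ c′ V f → ∀ a → U a →
                   Embeds γ c (Below γ U a) γ′ c′ (Below γ′ V (f a)) f
    embeds-below E a a∈U = record
      { into   = λ x (x∈U , x<a) → E.into x x∈U , E.mono _ _ x∈U a∈U x<a
      ; onto   = λ y (y∈V , y<fa) → let (x , x∈U , fx≡y) = E.onto y y∈V in
                  x , (x∈U , cancel E x∈U a∈U (subst (O′._< _) (sym fx≡y) y<fa)) , fx≡y
      ; mono   = λ x x′ (x∈U , _) (x′∈U , _) → E.mono x x′ x∈U x′∈U
      ; colors = λ x (x∈U , _) → E.colors x x∈U
      } where module E = Embeds E

    embeds-above : ∀ {U V} → Embeds γ c U γ′ c′ V f → ∀ a → U a →
                   Embeds γ c (Above γ U a) γ′ c′ (Above γ′ V (f a)) f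
    embeds-above E a a∈U = record
      { into   = λ x (x∈U , a<x) → E.into x x∈U , E.mono _ _ a∈U x∈U a<x
      ; onto   = λ y (y∈V , fa<y) → let (x , x∈U , fx≡y) = E.onto y y∈V in
                  x , (x∈U , cancel E a∈U x∈U (subst (_ O′.<_) (sym fx≡y) fa<y)) , fx≡y
      ; mono   = λ x x′ (x∈U , _) (x′∈U , _) → E.mono x x′ x∈U x′∈U
      ; colors = λ x (x∈U , _) → E.colors x x∈U
      } where module E = Embeds E

    tp-embeds : ∀ q {U V} → Embeds γ c U γ′ c′ V f → tp q γ c U ≡ tp q γ′ c′ V
    tp-embeds zero    E = refl
    tp-embeds (suc q) E = tp-ext q γ γ′
      (λ a a∈U → f a , match (E.into a a∈U) (tp-embeds q (embeds-below E a a∈U)) (E.colors a a∈U)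
                             (tp-embeds q (embeds-above E a a∈U)))
      (λ b b∈V → case-onto b b∈V)
      where
      module E = Embeds E
      case-onto : ∀ b → _ → _
      case-onto b b∈V with E.onto b b∈V
      ... | a , a∈U , refl = a , match a∈U (sym (tp-embeds q (embeds-below E a a∈U)))
                                   (sym (E.colors a a∈U)) (sym (tp-embeds q (embeds-above E a a∈U)))

  tp-cong : ∀ q (γ : Ordinal ℓ) {c c′ : Coloring γ} {U V : Pred (Carrier γ) ℓ} →
            (∀ x → U x → V x) → (∀ x → V x → U x) → (∀ x → U x → c x ≡ c′ x) →
            tp q γ c U ≡ tp q γ c′ V
  tp-cong q γ {c} {c′} {U} {V} U⊆V V⊆U c≗c′ = tp-embeds q identity
    where
    identity : Embeds γ c U γ c′ V id
    identity = record
      { into   = U⊆V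
      ; onto   = λ y y∈V → y , V⊆U y y∈V , refl
      ; mono   = λ _ _ _ _ x<x′ → x<x′
      ; colors = c≗c′
      }

  -- Types of ordered sums

  infixr 5 _∪_
  _∪_ : ∀ {A : Set ℓ} → Pred A ℓ → Pred A ℓ → Pred A ℓ
  (U ∪ V) x = U x ⊎ V x

  Before : (γ : Ordinal ℓ) → Pred (Carrier γ) ℓ → Pred (Carrier γ) ℓ → Set ℓ
  Before γ U V = ∀ {x y} → U x → V y → Ordinal._<_ γ x y

  module _ (q : ℕ) where
    match-cong : ∀ (γ γ′ : Ordinal ℓ) {c c′ U U′ V V′ a b} →
                 (∀ x → U x → U′ x) → (∀ x → U′ x → U x) → (∀ x → V x → V′ x) → (∀ x → V′ x → V x) →
                 Match q γ c U γ′ c′ V a b → Match q γ c U′ γ′ c′ V′ a b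
    match-cong γ γ′ U⊆U′ U′⊆U V⊆V′ V′⊆V (match b∈V eqˡ eqᶜ eqʳ) = match (V⊆V′ _ b∈V)
      (trans (tp-cong q γ (λ x (x∈U′ , p) → U′⊆U x x∈U′ , p) (λ x (x∈U , p) → U⊆U′ x x∈U , p) (λ _ _ → refl))
        (trans eqˡ
          (tp-cong q γ′ (λ x (x∈V , p) → V⊆V′ x x∈V , p) (λ x (x∈V′ , p) → V′⊆V x x∈V′ , p) (λ _ _ → refl))))
      eqᶜ
      (trans (tp-cong q γ (λ x (x∈U′ , p) → U′⊆U x x∈U′ , p) (λ x (x∈U , p) → U⊆U′ x x∈U , p) (λ _ _ → refl))
        (trans eqʳ
          (tp-cong q γ′ (λ x (x∈V , p) → V⊆V′ x x∈V , p) (λ x (x∈V′ , p) → V′⊆V x x∈V′ , p) (λ _ _ → refl))))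

  module _ (q : ℕ) (γ : Ordinal ℓ) {c : Coloring γ} {U₁ U₂ : Pred (Carrier γ) ℓ}
           (U₁<U₂ : Before γ U₁ U₂) (a : Carrier γ) where

    below-∪ˡ : U₁ a → tp q γ c (Below γ (U₁ ∪ U₂) a) ≡ tp q γ c (Below γ U₁ a)
    below-∪ˡ a∈U₁ = tp-cong q γ
      (λ { x (inj₁ x∈U₁ , x<a) → x∈U₁ , x<a
         ; x (inj₂ x∈U₂ , x<a) → contradiction x<a (Order.<-asym γ (U₁<U₂ a∈U₁ x∈U₂)) })
      (λ x (x∈U₁ , x<a) → inj₁ x∈U₁ , x<a) (λ _ _ → refl)

    above-∪ˡ : U₁ a → tp q γ c (Above γ (U₁ ∪ U₂) a) ≡ tp q γ c (Above γ U₁ a ∪ U₂)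
    above-∪ˡ a∈U₁ = tp-cong q γ
      (λ { x (inj₁ x∈U₁ , a<x) → inj₁ (x∈U₁ , a<x) ; x (inj₂ x∈U₂ , a<x) → inj₂ x∈U₂ })
      (λ { x (inj₁ (x∈U₁ , a<x)) → inj₁ x∈U₁ , a<x ; x (inj₂ x∈U₂) → inj₂ x∈U₂ , U₁<U₂ a∈U₁ x∈U₂ })
      (λ _ _ → refl)

    below-∪ʳ : U₂ a → tp q γ c (Below γ (U₁ ∪ U₂) a) ≡ tp q γ c (U₁ ∪ Below γ U₂ a)
    below-∪ʳ a∈U₂ = tp-cong q γ
      (λ { x (inj₂ x∈U₂ , x<a) → inj₂ (x∈U₂ , x<a) ; x (inj₁ x∈U₁ , _) → inj₁ x∈U₁ })
      (λ { x (inj₂ (x∈U₂ , x<a)) → inj₂ x∈U₂ , x<a ; x (inj₁ x∈U₁) → inj₁ x∈U₁ , U₁<U₂ x∈U₁ a∈U₂ })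
      (λ _ _ → refl)

    above-∪ʳ : U₂ a → tp q γ c (Above γ (U₁ ∪ U₂) a) ≡ tp q γ c (Above γ U₂ a)
    above-∪ʳ a∈U₂ = tp-cong q γ
      (λ { x (inj₂ x∈U₂ , a<x) → x∈U₂ , a<x
         ; x (inj₁ x∈U₁ , a<x) → contradiction a<x (Order.<-asym γ (U₁<U₂ x∈U₁ a∈U₂)) })
      (λ x (x∈U₂ , a<x) → inj₂ x∈U₂ , a<x) (λ _ _ → refl)

  -- A point chosen in one summand splits that summand only; the other is carried along whole, at
  -- the lower rank.
  tp-∪ : ∀ q (γ γ′ : Ordinal ℓ) {c c′ U₁ U₂ V₁ V₂} → Before γ U₁ U₂ → Before γ′ V₁ V₂ →
         tp q γ c U₁ ≡ tp q γ′ c′ V₁ → tp q γ c U₂ ≡ tp q γ′ c′ V₂ →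
         tp q γ c (U₁ ∪ U₂) ≡ tp q γ′ c′ (V₁ ∪ V₂)

  -- Only the summand that contains the point has to agree at the higher rank. The induction in
  -- `tail-unique` rests on this asymmetry.
  match-∪ˡ : ∀ q (γ γ′ : Ordinal ℓ) {c c′ U₁ U₂ V₁ V₂} → Before γ U₁ U₂ → Before γ′ V₁ V₂ →
             tp (suc q) γ c U₁ ≡ tp (suc q) γ′ c′ V₁ → tp q γ c U₂ ≡ tp q γ′ c′ V₂ →
             ∀ a → U₁ a → ∃[ b ] Match q γ c (U₁ ∪ U₂) γ′ c′ (V₁ ∪ V₂) a b
  match-∪ˡ q γ γ′ U₁<U₂ V₁<V₂ eq₁ eq₂ a a∈U₁ with tp-forth q γ γ′ eq₁ a a∈U₁
  ... | b , match b∈V₁ eqˡ eqᶜ eqʳ = b , match (inj₁ b∈V₁)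
    (trans (below-∪ˡ q γ U₁<U₂ a a∈U₁) (trans eqˡ (sym (below-∪ˡ q γ′ V₁<V₂ b b∈V₁)))) eqᶜ
    (trans (above-∪ˡ q γ U₁<U₂ a a∈U₁)
      (trans (tp-∪ q γ γ′ (λ (x∈U₁ , _) → U₁<U₂ x∈U₁) (λ (x∈V₁ , _) → V₁<V₂ x∈V₁) eqʳ eq₂)
        (sym (above-∪ˡ q γ′ V₁<V₂ b b∈V₁))))

  tp-∪ zero    γ γ′ _ _ _ _ = refl
  tp-∪ (suc q) γ γ′ U₁<U₂ V₁<V₂ eq₁ eq₂ =
    tp-ext q γ γ′ (half γ γ′ U₁<U₂ V₁<V₂ eq₁ eq₂) (half γ′ γ V₁<V₂ U₁<U₂ (sym eq₁) (sym eq₂))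
    where
    half : ∀ γ γ′ {c c′ U₁ U₂ V₁ V₂} → Before γ U₁ U₂ → Before γ′ V₁ V₂ →
           tp (suc q) γ c U₁ ≡ tp (suc q) γ′ c′ V₁ → tp (suc q) γ c U₂ ≡ tp (suc q) γ′ c′ V₂ →
           ∀ a → (U₁ ∪ U₂) a → ∃[ b ] Match q γ c (U₁ ∪ U₂) γ′ c′ (V₁ ∪ V₂) a b
    half γ γ′ U₁<U₂ V₁<V₂ eq₁ eq₂ a (inj₁ a∈U₁) =
      match-∪ˡ q γ γ′ U₁<U₂ V₁<V₂ eq₁ (tp-down q γ γ′ eq₂) a a∈U₁
    half γ γ′ U₁<U₂ V₁<V₂ eq₁ eq₂ a (inj₂ a∈U₂) with tp-forth q γ γ′ eq₂ a a∈U₂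
    ... | b , match b∈V₂ eqˡ eqᶜ eqʳ = b , match (inj₂ b∈V₂)
      (trans (below-∪ʳ q γ U₁<U₂ a a∈U₂)
        (trans (tp-∪ q γ γ′ (λ x∈U₁ (y∈U₂ , _) → U₁<U₂ x∈U₁ y∈U₂) (λ x∈V₁ (y∈V₂ , _) → V₁<V₂ x∈V₁ y∈V₂)
                     (tp-down q γ γ′ eq₁) eqˡ)
          (sym (below-∪ʳ q γ′ V₁<V₂ b b∈V₂)))) eqᶜ
      (trans (above-∪ʳ q γ U₁<U₂ a a∈U₂) (trans eqʳ (sym (above-∪ʳ q γ′ V₁<V₂ b b∈V₂))))

  Interval : (γ : Ordinal ℓ) → Carrier γ → Carrier γ → Pred (Carrier γ) ℓ
  Interval γ a b x = a ≤ x × x < b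
    where open Order γ

  module _ (γ : Ordinal ℓ) where
    open Order γ

    interval-split : ∀ {a p b} → a ≤ p → p ≤ b →
                     (∀ x → Interval γ a b x → (Interval γ a p ∪ Interval γ p b) x) ×
                     (∀ x → (Interval γ a p ∪ Interval γ p b) x → Interval γ a b x)
    interval-split {a} {p} {b} a≤p p≤b = to , from
      where
      to : ∀ x → Interval γ a b x → (Interval γ a p ∪ Interval γ p b) x
      to x (a≤x , x<b) with <-≤-connex x p
      ... | inj₁ x<p = inj₁ (a≤x , x<p)
      ... | inj₂ p≤x = inj₂ (p≤x , x<b)
      from : ∀ x → (Interval γ a p ∪ Interval γ p b) x → Interval γ a b x
      from x (inj₁ (a≤x , x<p)) = a≤x , <-≤-trans x<p p≤b
      from x (inj₂ (p≤x , x<b)) = ≤-trans a≤p p≤x , x<b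

    interval-before : ∀ {a p b} → Before γ (Interval γ a p) (Interval γ p b)
    interval-before (_ , x<p) (p≤y , _) = <-≤-trans x<p p≤y

  tp-interval-+ : ∀ q (γ γ′ : Ordinal ℓ) {c c′ a p b a′ p′ b′} → let open Order in
    _≤_ γ a p → _≤_ γ p b → _≤_ γ′ a′ p′ → _≤_ γ′ p′ b′ →
    tp q γ c (Interval γ a p) ≡ tp q γ′ c′ (Interval γ′ a′ p′) →
    tp q γ c (Interval γ p b) ≡ tp q γ′ c′ (Interval γ′ p′ b′) →
    tp q γ c (Interval γ a b) ≡ tp q γ′ c′ (Interval γ′ a′ b′)
  tp-interval-+ q γ γ′ a≤p p≤b a′≤p′ p′≤b′ eq₁ eq₂ =
    let (to , from)   = interval-split γ a≤p p≤b
        (to′ , from′) = interval-split γ′ a′≤p′ p′≤b′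
    in trans (tp-cong q γ to from (λ _ _ → refl))
         (trans (tp-∪ q γ γ′ (interval-before γ) (interval-before γ′) eq₁ eq₂)
           (tp-cong q γ′ from′ to′ (λ _ _ → refl)))

  tp-empty : ∀ q (γ γ′ : Ordinal ℓ) {c c′ U V} → (∀ x → ¬ U x) → (∀ x → ¬ V x) →
             tp q γ c U ≡ tp q γ′ c′ V
  tp-empty zero    γ γ′ _ _ = refl
  tp-empty (suc q) γ γ′ U-empty V-empty = tp-ext q γ γ′
    (λ a a∈U → contradiction a∈U (U-empty a)) (λ b b∈V → contradiction b∈V (V-empty b))

  module _ (κ : Ordinal ℓ) where
    private
      module K = Order κ

    Fibred : (γ : Ordinal ℓ) → (Carrier γ → Carrier κ) → Set ℓ
    Fibred γ π = ∀ {x y} → π x K.< π y → Ordinal._<_ γ x y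

    Fibre : (γ : Ordinal ℓ) → (Carrier γ → Carrier κ) → Pred (Carrier γ) ℓ → Carrier κ → Pred (Carrier γ) ℓ
    Fibre γ π U i x = U x × π x ≡ i

    -- The chosen point splits its own fibre; earlier fibres fall entirely below it and later ones
    -- entirely above, so for those agreement at the lower rank suffices.
    tp-Σ : ∀ q (γ γ′ : Ordinal ℓ) {c c′ U V} (π : Carrier γ → Carrier κ) (π′ : Carrier γ′ → Carrier κ) →
           Fibred γ π → Fibred γ′ π′ →
           (∀ i → tp q γ c (Fibre γ π U i) ≡ tp q γ′ c′ (Fibre γ′ π′ V i)) →
           tp q γ c U ≡ tp q γ′ c′ V
    tp-Σ zero    γ γ′ π π′ _ _ _ = refl
    tp-Σ (suc q) γ γ′ π π′ mono mono′ eq =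
      tp-ext q γ γ′ (half γ γ′ π π′ mono mono′ eq) (half γ′ γ π′ π mono′ mono (λ i → sym (eq i)))
      where
      module _ (γ : Ordinal ℓ) {c : Coloring γ} {U : Pred (Carrier γ) ℓ} {π : Carrier γ → Carrier κ}
               (mono : Fibred γ π) {a : Carrier γ} where
        open Order γ

        below-< : ∀ {j} → j K.< π a → tp q γ c (Fibre γ π (Below γ U a) j) ≡ tp q γ c (Fibre γ π U j)
        below-< j<πa = tp-cong q γ (λ { x ((x∈U , _) , πx≡j) → x∈U , πx≡j })
          (λ { x (x∈U , refl) → (x∈U , mono j<πa) , refl }) (λ _ _ → refl)

        above-> : ∀ {j} → π a K.< j → tp q γ c (Fibre γ π (Above γ U a) j) ≡ tp q γ c (Fibre γ π U j)
        above-> πa<j = tp-cong q γ (λ { x ((x∈U , _) , πx≡j) → x∈U , πx≡j })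
          (λ { x (x∈U , refl) → (x∈U , mono πa<j) , refl }) (λ _ _ → refl)

        below-≡ : ∀ {j} → tp q γ c (Fibre γ π (Below γ U a) j) ≡ tp q γ c (Below γ (Fibre γ π U j) a)
        below-≡ = tp-cong q γ (λ x ((x∈U , x<a) , πx≡j) → (x∈U , πx≡j) , x<a)
          (λ x ((x∈U , πx≡j) , x<a) → (x∈U , x<a) , πx≡j) (λ _ _ → refl)

        above-≡ : ∀ {j} → tp q γ c (Fibre γ π (Above γ U a) j) ≡ tp q γ c (Above γ (Fibre γ π U j) a)
        above-≡ = tp-cong q γ (λ x ((x∈U , a<x) , πx≡j) → (x∈U , πx≡j) , a<x)
          (λ x ((x∈U , πx≡j) , a<x) → (x∈U , a<x) , πx≡j) (λ _ _ → refl)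

        below-> : ∀ {j} → π a K.< j → ∀ x → ¬ Fibre γ π (Below γ U a) j x
        below-> πa<j x ((_ , x<a) , refl) = <-asym x<a (mono πa<j)

        above-< : ∀ {j} → j K.< π a → ∀ x → ¬ Fibre γ π (Above γ U a) j x
        above-< j<πa x ((_ , a<x) , refl) = <-asym a<x (mono j<πa)

      half : ∀ γ γ′ {c c′ U V} (π : Carrier γ → Carrier κ) (π′ : Carrier γ′ → Carrier κ) →
             Fibred γ π → Fibred γ′ π′ →
             (∀ i → tp (suc q) γ c (Fibre γ π U i) ≡ tp (suc q) γ′ c′ (Fibre γ′ π′ V i)) →
             ∀ a → U a → ∃[ b ] Match q γ c U γ′ c′ V a b
      half γ γ′ {c} {c′} {U} {V} π π′ mono mono′ eq a a∈U
        with tp-forth q γ γ′ (eq (π a)) a (a∈U , refl)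
      ... | b , match (b∈V , π′b≡πa) eqˡ eqᶜ eqʳ = b , match b∈V
        (tp-Σ q γ γ′ π π′ mono mono′ below) eqᶜ (tp-Σ q γ γ′ π π′ mono mono′ above)
        where
        below : ∀ j → tp q γ c (Fibre γ π (Below γ U a) j) ≡ tp q γ′ c′ (Fibre γ′ π′ (Below γ′ V b) j)
        below j with K.compare j (π a)
        ... | tri< j<πa _ _ = trans (below-< γ mono j<πa)
                (trans (tp-down q γ γ′ (eq j)) (sym (below-< γ′ mono′ (subst (j K.<_) (sym π′b≡πa) j<πa))))
        ... | tri≈ _ refl _ = trans (below-≡ γ mono) (trans eqˡ (sym (below-≡ γ′ mono′)))
        ... | tri> _ _ πa<j = tp-empty q γ γ′ (below-> γ {c} mono πa<j)
                (below-> γ′ {c′} mono′ (subst (K._< j) (sym π′b≡πa) πa<j))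
        above : ∀ j → tp q γ c (Fibre γ π (Above γ U a) j) ≡ tp q γ′ c′ (Fibre γ′ π′ (Above γ′ V b) j)
        above j with K.compare j (π a)
        ... | tri< j<πa _ _ = tp-empty q γ γ′ (above-< γ {c} mono j<πa)
                (above-< γ′ {c′} mono′ (subst (j K.<_) (sym π′b≡πa) j<πa))
        ... | tri≈ _ refl _ = trans (above-≡ γ mono) (trans eqʳ (sym (above-≡ γ′ mono′)))
        ... | tri> _ _ πa<j = trans (above-> γ mono πa<j)
                (trans (tp-down q γ γ′ (eq j)) (sym (above-> γ′ mono′ (subst (K._< j) (sym π′b≡πa) πa<j))))

  -- Types determine sentences: the Ehrenfeucht-Fraïssé game

  -- Positions of the Ehrenfeucht–Fraïssé game with p rounds left, as search
  -- trees: the nodes are the pairs of elements played so far, the leaves the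
  -- gaps between them.
  data Position (p : ℕ) (γ γ′ : Ordinal ℓ) (c : Coloring γ) (c′ : Coloring γ′) :
                Pred (Carrier γ) ℓ → Pred (Carrier γ′) ℓ → Set (lsuc ℓ) where
    leaf : ∀ {U V} → tp p γ c U ≡ tp p γ′ c′ V → Position p γ γ′ c c′ U V
    node : ∀ {U V} a b → U a → V b → c a ≡ c′ b →
           Position p γ γ′ c c′ (Below γ U a) (Below γ′ V b) →
           Position p γ γ′ c c′ (Above γ U a) (Above γ′ V b) → Position p γ γ′ c c′ U V

  module _ {γ γ′ : Ordinal ℓ} {c : Coloring γ} {c′ : Coloring γ′} where
    private
      module O = Order γ
      module O′ = Order γ′

    Played : ∀ {p U V} → Position p γ γ′ c c′ U V → Carrier γ → Carrier γ′ → Set ℓ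
    Played (leaf _)             x y = ⊥
    Played (node a b _ _ _ l r) x y = Played l x y ⊎ (x ≡ a × y ≡ b) ⊎ Played r x y

    played∈ : ∀ {p U V} (t : Position p γ γ′ c c′ U V) {x y} → Played t x y → U x × V y
    played∈ (node a b a∈U b∈V _ l r) (inj₁ m) with played∈ l m
    ... | (x∈U , _) , (y∈V , _) = x∈U , y∈V
    played∈ (node a b a∈U b∈V _ l r) (inj₂ (inj₁ (refl , refl))) = a∈U , b∈V
    played∈ (node a b a∈U b∈V _ l r) (inj₂ (inj₂ m)) with played∈ r m
    ... | (x∈U , _) , (y∈V , _) = x∈U , y∈V

    played-color : ∀ {p U V} (t : Position p γ γ′ c c′ U V) {x y} → Played t x y → c x ≡ c′ y
    played-color (node a b _ _ _ l r)  (inj₁ m)                     = played-color l m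
    played-color (node a b _ _ eq l r) (inj₂ (inj₁ (refl , refl))) = eq
    played-color (node a b _ _ _ l r)  (inj₂ (inj₂ m))              = played-color r m

    SameOrder : Carrier γ → Carrier γ′ → Carrier γ → Carrier γ′ → Set ℓ
    SameOrder x y x′ y′ = (x O.< x′ × y O′.< y′) ⊎ (x ≡ x′ × y ≡ y′) ⊎ (x′ O.< x × y′ O′.< y)

    played-order : ∀ {p U V} (t : Position p γ γ′ c c′ U V) {x y x′ y′} →
                   Played t x y → Played t x′ y′ → SameOrder x y x′ y′
    played-order (node a b _ _ _ l r) (inj₁ m) (inj₁ m′) = played-order l m m′
    played-order (node a b _ _ _ l r) (inj₁ m) (inj₂ (inj₁ (refl , refl))) with played∈ l m
    ... | (_ , x<a) , (_ , y<b) = inj₁ (x<a , y<b)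
    played-order (node a b _ _ _ l r) (inj₁ m) (inj₂ (inj₂ m′)) with played∈ l m | played∈ r m′
    ... | (_ , x<a) , (_ , y<b) | (_ , a<x′) , (_ , b<y′) = inj₁ (O.<-trans x<a a<x′ , O′.<-trans y<b b<y′)
    played-order (node a b _ _ _ l r) (inj₂ (inj₁ (refl , refl))) (inj₁ m′) with played∈ l m′
    ... | (_ , x<a) , (_ , y<b) = inj₂ (inj₂ (x<a , y<b))
    played-order (node a b _ _ _ l r) (inj₂ (inj₁ (refl , refl))) (inj₂ (inj₁ (refl , refl))) =
      inj₂ (inj₁ (refl , refl))
    played-order (node a b _ _ _ l r) (inj₂ (inj₁ (refl , refl))) (inj₂ (inj₂ m′)) with played∈ r m′
    ... | (_ , a<x) , (_ , b<y) = inj₁ (a<x , b<y)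
    played-order (node a b _ _ _ l r) (inj₂ (inj₂ m)) (inj₁ m′) with played∈ r m | played∈ l m′
    ... | (_ , a<x) , (_ , b<y) | (_ , x′<a) , (_ , y′<b) =
      inj₂ (inj₂ (O.<-trans x′<a a<x , O′.<-trans y′<b b<y))
    played-order (node a b _ _ _ l r) (inj₂ (inj₂ m)) (inj₂ (inj₁ (refl , refl))) with played∈ r m
    ... | (_ , a<x) , (_ , b<y) = inj₂ (inj₂ (a<x , b<y))
    played-order (node a b _ _ _ l r) (inj₂ (inj₂ m)) (inj₂ (inj₂ m′)) = played-order r m m′

    pass : ∀ {p U V} (t : Position (suc p) γ γ′ c c′ U V) →
           Σ[ t′ ∈ Position p γ γ′ c c′ U V ] (∀ {x y} → Played t x y → Played t′ x y)
    pass {p} (leaf eq) = leaf (tp-down p γ γ′ eq) , λ ()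
    pass (node a b a∈U b∈V eq l r) with pass l | pass r
    ... | l′ , l⊆ | r′ , r⊆ = node a b a∈U b∈V eq l′ r′ ,
      λ { (inj₁ m) → inj₁ (l⊆ m) ; (inj₂ (inj₁ m)) → inj₂ (inj₁ m) ; (inj₂ (inj₂ m)) → inj₂ (inj₂ (r⊆ m)) }

    -- Only the gap that receives the new element is split; all other gaps merely lose a round. An
    -- element that is already played is answered by its partner.
    respond : ∀ {p U V} (t : Position (suc p) γ γ′ c c′ U V) a → U a →
              Σ[ t′ ∈ Position p γ γ′ c c′ U V ]
                ∃[ b ] (Played t′ a b × (∀ {x y} → Played t x y → Played t′ x y))
    respond {p} (leaf eq) a a∈U with tp-forth p γ γ′ eq a a∈U
    ... | b , match b∈V eqˡ eqᶜ eqʳ =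
      node a b a∈U b∈V eqᶜ (leaf eqˡ) (leaf eqʳ) , b , inj₂ (inj₁ (refl , refl)) , λ ()
    respond (node a b a∈U b∈V eq l r) x x∈U with O.compare x a
    ... | tri≈ _ refl _ with pass l | pass r
    ... | l′ , l⊆ | r′ , r⊆ = node a b a∈U b∈V eq l′ r′ , b , inj₂ (inj₁ (refl , refl)) ,
      λ { (inj₁ m) → inj₁ (l⊆ m) ; (inj₂ (inj₁ m)) → inj₂ (inj₁ m) ; (inj₂ (inj₂ m)) → inj₂ (inj₂ (r⊆ m)) }
    respond (node a b a∈U b∈V eq l r) x x∈U | tri< x<a _ _ with respond l x (x∈U , x<a) | pass r
    ... | l′ , y , m , l⊆ | r′ , r⊆ = node a b a∈U b∈V eq l′ r′ , y , inj₁ m ,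
      λ { (inj₁ m) → inj₁ (l⊆ m) ; (inj₂ (inj₁ m)) → inj₂ (inj₁ m) ; (inj₂ (inj₂ m)) → inj₂ (inj₂ (r⊆ m)) }
    respond (node a b a∈U b∈V eq l r) x x∈U | tri> _ _ a<x with pass l | respond r x (x∈U , a<x)
    ... | l′ , l⊆ | r′ , y , m , r⊆ = node a b a∈U b∈V eq l′ r′ , y , inj₂ (inj₂ m) ,
      λ { (inj₁ m) → inj₁ (l⊆ m) ; (inj₂ (inj₁ m)) → inj₂ (inj₁ m) ; (inj₂ (inj₂ m)) → inj₂ (inj₂ (r⊆ m)) }

  flip-position : ∀ {p γ γ′ c c′ U V} (t : Position p γ γ′ c c′ U V) →
                  Σ[ t′ ∈ Position p γ′ γ c′ c V U ] (∀ {x y} → Played t x y → Played t′ y x)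
  flip-position (leaf eq) = leaf (sym eq) , λ ()
  flip-position (node a b a∈U b∈V eq l r) with flip-position l | flip-position r
  ... | l′ , l⊆ | r′ , r⊆ = node b a b∈V a∈U (sym eq) l′ r′ ,
    λ { (inj₁ m) → inj₁ (l⊆ m) ; (inj₂ (inj₁ (eq₁ , eq₂))) → inj₂ (inj₁ (eq₂ , eq₁))
      ; (inj₂ (inj₂ m)) → inj₂ (inj₂ (r⊆ m)) }

  colored : (γ : Ordinal ℓ) → Coloring γ → ColoredOrdinal d ℓ
  colored γ c = record
    { ordinal   = γ
    ; C         = λ i a → Lift ℓ (c a ≡ i)
    ; partition = λ a → c a , lift refl , lower
    }

  coloring : (𝔄 : ColoredOrdinal d ℓ) → Coloring (ColoredOrdinal.ordinal 𝔄)
  coloring 𝔄 a = proj₁ (ColoredOrdinal.partition 𝔄 a)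

  Game : ℕ → ColoredOrdinal d ℓ → ColoredOrdinal d ℓ → Set (lsuc ℓ)
  Game p 𝔄 𝔅 = Position p (ColoredOrdinal.ordinal 𝔄) (ColoredOrdinal.ordinal 𝔅)
                        (coloring 𝔄) (coloring 𝔅) (λ _ → ⊤) (λ _ → ⊤)

  transfer : ∀ 𝔄 𝔅 {n} (φ : Formula d n) {p} → rank φ ℕ.≤ p → ∀ ρ ρ′ (t : Game p 𝔄 𝔅) →
             (∀ i → Played t (lookup ρ i) (lookup ρ′ i)) →
             Satisfies (ColoredOrdinal.structure 𝔄) ρ φ → Satisfies (ColoredOrdinal.structure 𝔅) ρ′ φ
  transfer 𝔄 𝔅 (x ≐ y) _ ρ ρ′ t m eq with played-order t (m x) (m y)
  ... | inj₁ (lt , _)              = contradiction lt (Order.<-irrefl (ColoredOrdinal.ordinal 𝔄) eq)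
  ... | inj₂ (inj₁ (_ , eq′))      = eq′
  ... | inj₂ (inj₂ (gt , _))       = contradiction gt (Order.<-irrefl (ColoredOrdinal.ordinal 𝔄) (sym eq))
  transfer 𝔄 𝔅 (x ≺ y) _ ρ ρ′ t m lt with played-order t (m x) (m y)
  ... | inj₁ (_ , lt′)             = lt′
  ... | inj₂ (inj₁ (eq , _))       = contradiction lt (Order.<-irrefl (ColoredOrdinal.ordinal 𝔄) eq)
  ... | inj₂ (inj₂ (gt , _))       = contradiction gt (Order.<-asym (ColoredOrdinal.ordinal 𝔄) lt)
  transfer 𝔄 𝔅 (color i x) _ ρ ρ′ t m c∈ =
    subst (λ j → ColoredOrdinal.C 𝔅 j (lookup ρ′ x))
      (trans (sym (played-color t (m x))) (proj₂ (proj₂ (ColoredOrdinal.partition 𝔄 (lookup ρ x))) c∈))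
      (proj₁ (proj₂ (ColoredOrdinal.partition 𝔅 (lookup ρ′ x))))
  transfer 𝔄 𝔅 (¬′ φ) r≤p ρ ρ′ t m ¬φ φ′ =
    let (t′ , ⊆t′) = flip-position t in ¬φ (transfer 𝔅 𝔄 φ r≤p ρ′ ρ t′ (λ i → ⊆t′ (m i)) φ′)
  transfer 𝔄 𝔅 (φ ∧′ ψ) r≤p ρ ρ′ t m (s , s′) =
    transfer 𝔄 𝔅 φ (ℕₚ.m⊔n≤o⇒m≤o _ _ r≤p) ρ ρ′ t m s , transfer 𝔄 𝔅 ψ (ℕₚ.m⊔n≤o⇒n≤o (rank φ) _ r≤p) ρ ρ′ t m s′
  transfer 𝔄 𝔅 (φ ∨′ ψ) r≤p ρ ρ′ t m (inj₁ s) = inj₁ (transfer 𝔄 𝔅 φ (ℕₚ.m⊔n≤o⇒m≤o _ _ r≤p) ρ ρ′ t m s)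
  transfer 𝔄 𝔅 (φ ∨′ ψ) r≤p ρ ρ′ t m (inj₂ s) = inj₂ (transfer 𝔄 𝔅 ψ (ℕₚ.m⊔n≤o⇒n≤o (rank φ) _ r≤p) ρ ρ′ t m s)
  transfer 𝔄 𝔅 (φ ⇒′ ψ) r≤p ρ ρ′ t m s s′ =
    let (t′ , ⊆t′) = flip-position t in
    transfer 𝔄 𝔅 ψ (ℕₚ.m⊔n≤o⇒n≤o (rank φ) _ r≤p) ρ ρ′ t m
      (s (transfer 𝔅 𝔄 φ (ℕₚ.m⊔n≤o⇒m≤o _ _ r≤p) ρ′ ρ t′ (λ i → ⊆t′ (m i)) s′))
  -- Here the move is made in `𝔅`: the position is turned around, answered, and turned back.
  transfer 𝔄 𝔅 (∀′ φ) (ℕ.s≤s r≤p) ρ ρ′ t m s b =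
    let (t₁ , ⊆t₁)          = flip-position t
        (t₂ , a , ba , ⊆t₂) = respond t₁ b tt
        (t₃ , ⊆t₃)          = flip-position t₂
    in transfer 𝔄 𝔅 φ r≤p (a ∷ ρ) (b ∷ ρ′) t₃
         (λ { zero → ⊆t₃ ba ; (suc i) → ⊆t₃ (⊆t₂ (⊆t₁ (m i))) }) (s a)
  transfer 𝔄 𝔅 (∃′ φ) (ℕ.s≤s r≤p) ρ ρ′ t m (a , s) =
    let (t′ , b , ab , ⊆t′) = respond t a tt
    in b , transfer 𝔄 𝔅 φ r≤p (a ∷ ρ) (b ∷ ρ′) t′ (λ { zero → ab ; (suc i) → ⊆t′ (m i) }) s

  ≡type⇒≡[] : ∀ q 𝔄 𝔅 →
    tp q (ColoredOrdinal.ordinal 𝔄) (coloring 𝔄) (λ _ → ⊤) ≡ tp q (ColoredOrdinal.ordinal 𝔅) (coloring 𝔅) (λ _ → ⊤) →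
    𝔄 ≡[ q ] 𝔅
  ≡type⇒≡[] q 𝔄 𝔅 eq φ r≤q = mk⇔ (transfer 𝔄 𝔅 φ r≤q [] [] (leaf eq) (λ ()))
                                  (transfer 𝔅 𝔄 φ r≤q [] [] (leaf (sym eq)) (λ ()))

-- Homogeneous sets and the additive Ramsey argument

module AtRank (em : Classical) (ℓ : Level) (d : ℕ) (Q : ℕ) (0<Q : 0 ℕ.< Q) where
  open Types em ℓ d

  τ : (γ : Ordinal ℓ) → Coloring γ → Carrier γ → Carrier γ → Type Q
  τ γ c a b = tp Q γ c (Interval γ a b)

  tp-≤ : ∀ {q} → q ℕ.≤ Q → ∀ (γ γ′ : Ordinal ℓ) {c c′ U V} → tp Q γ c U ≡ tp Q γ′ c′ V →
         tp q γ c U ≡ tp q γ′ c′ V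
  tp-≤ q≤Q γ γ′ = go (ℕₚ.≤⇒≤′ q≤Q)
    where
    go : ∀ {q p} → q ℕ.≤′ p → ∀ {c c′ U V} → tp p γ c U ≡ tp p γ′ c′ V → tp q γ c U ≡ tp q γ′ c′ V
    go ℕ.≤′-refl       eq = eq
    go (ℕ.≤′-step {p} q≤p) eq = go q≤p (tp-down p γ γ′ eq)

  -- The type `e` is demanded only from some `z` on that depends on `x`. Demanding it of all pairs
  -- would need a further transfinite thinning; this form comes directly from similarity at any
  -- cofinality, and it suffices to determine the type of the tail.
  record Homogeneous (γ : Ordinal ℓ) (c : Coloring γ) (b : Carrier γ)
                     (R : Pred (Carrier γ) ℓ) (e : Type Q) : Set ℓ where
    open Order γ
    field
      cofinal    : ∀ v → v < b → ∃[ y ] (v < y × y < b × R y)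
      eventually : ∀ x → x < b → R x → ∃[ z ] (z < b × ∀ y → z < y → y < b → R y → τ γ c x y ≡ e)

    beyond : ∀ x → x < b → R x → ∀ v → v < b → ∃[ y ] (x < y × v < y × y < b × R y × τ γ c x y ≡ e)
    beyond x x<b x∈R v v<b with eventually x x<b x∈R
    ... | z , z<b , hom with upperBound₂ z x z<b x<b
    ... | m , m<b , z≤m , x≤m with upperBound₂ m v m<b v<b
    ... | n , n<b , m≤n , v≤n with cofinal n n<b
    ... | y , n<y , y<b , y∈R = y , ≤-<-trans (≤-trans x≤m m≤n) n<y , ≤-<-trans v≤n n<y , y<b , y∈R ,
      hom y (≤-<-trans (≤-trans z≤m m≤n) n<y) y<b y∈R

  -- Spoiler's move is answered inside an initial interval of type e, and
  -- what remains beyond it are again two homogeneous tails.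
  tail-unique : ∀ {e} (γ γ′ : Ordinal ℓ) {c c′ b b′ R R′} →
                Homogeneous γ c b R e → Homogeneous γ′ c′ b′ R′ e →
                ∀ q → q ℕ.≤ Q → ∀ x x′ → Ordinal._<_ γ x b → R x → Ordinal._<_ γ′ x′ b′ → R′ x′ →
                tp q γ c (Interval γ x b) ≡ tp q γ′ c′ (Interval γ′ x′ b′)
  tail-unique γ γ′ H H′ zero    _   x x′ _ _ _ _ = refl
  tail-unique γ γ′ H H′ (suc q) q<Q x x′ x<b x∈R x′<b′ x′∈R′ =
    tp-ext q γ γ′ (half γ γ′ H H′ (tail-unique γ γ′ H H′ q (ℕₚ.<⇒≤ q<Q)) x x′ x<b x∈R x′<b′ x′∈R′)
                  (half γ′ γ H′ H (tail-unique γ′ γ H′ H q (ℕₚ.<⇒≤ q<Q)) x′ x x′<b′ x′∈R′ x<b x∈R)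
    where
    half : ∀ {e} (γ γ′ : Ordinal ℓ) {c c′ b b′ R R′} →
           Homogeneous γ c b R e → Homogeneous γ′ c′ b′ R′ e →
           (∀ x x′ → Ordinal._<_ γ x b → R x → Ordinal._<_ γ′ x′ b′ → R′ x′ →
             tp q γ c (Interval γ x b) ≡ tp q γ′ c′ (Interval γ′ x′ b′)) →
           ∀ x x′ → Ordinal._<_ γ x b → R x → Ordinal._<_ γ′ x′ b′ → R′ x′ →
           ∀ v → Interval γ x b v → ∃[ w ] Match q γ c (Interval γ x b) γ′ c′ (Interval γ′ x′ b′) v w
    half γ γ′ H H′ IH x x′ x<b x∈R x′<b′ x′∈R′ v (x≤v , v<b)
      with Homogeneous.beyond H x x<b x∈R v v<b | Homogeneous.beyond H′ x′ x′<b′ x′∈R′ x′ x′<b′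
    ... | y , x<y , v<y , y<b , y∈R , eq | y′ , x′<y′ , _ , y′<b′ , y′∈R′ , eq′
      with match-∪ˡ q γ γ′ (interval-before γ) (interval-before γ′)
             (tp-≤ q<Q γ γ′ (trans eq (sym eq′))) (IH y y′ y<b y∈R y′<b′ y′∈R′) v (x≤v , v<y)
         | interval-split γ (Order.<⇒≤ γ x<y) (Order.<⇒≤ γ y<b)
         | interval-split γ′ (Order.<⇒≤ γ′ x′<y′) (Order.<⇒≤ γ′ y′<b′)
    ... | w , m | to , from | to′ , from′ = w , match-cong q γ γ′ from to from′ to′ m

  -- s + t = u and, for idempotent e, e · ω = r.
  Plus : Type Q → Type Q → Type Q → Set (lsuc ℓ)
  Plus s t u = ∀ γ c {a p b} → let open Order γ in
               a ≤ p → p ≤ b → τ γ c a p ≡ s → τ γ c p b ≡ t → τ γ c a b ≡ u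

  Tail : Type Q → Type Q → Set (lsuc ℓ)
  Tail e r = ∀ γ c b R → Homogeneous γ c b R e → ∀ x → Ordinal._<_ γ x b → R x → τ γ c x b ≡ r

  plus : ∀ (γ : Ordinal ℓ) {c a p b} → let open Order γ in a ≤ p → p ≤ b →
         Plus (τ γ c a p) (τ γ c p b) (τ γ c a b)
  plus γ a≤p p≤b γ′ c′ a′≤p′ p′≤b′ eq₁ eq₂ = tp-interval-+ Q γ′ γ a′≤p′ p′≤b′ a≤p p≤b eq₁ eq₂

  tail : ∀ (γ : Ordinal ℓ) {c b R e} → Homogeneous γ c b R e → ∀ {x} → Ordinal._<_ γ x b → R x →
         Tail e (τ γ c x b)
  tail γ H x<b x∈R γ′ c′ b′ R′ H′ x′ x′<b′ x′∈R′ =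
    tail-unique γ′ γ H′ H Q ℕₚ.≤-refl x′ _ x′<b′ x′∈R′ x<b x∈R

  module Ramsey (γ : Ordinal ℓ) (c : Coloring γ) where
    open Order γ

    module _ {b : Carrier γ} where

      finite-bound : ∀ {n} (v : Fin n → Carrier γ) → (∀ i → v i < b) → ∀ a → a < b →
                     ∃[ z ] (z < b × a ≤ z × ∀ i → v i ≤ z)
      finite-bound {zero}  v v<b a a<b = a , a<b , ≤-refl , λ ()
      finite-bound {suc n} v v<b a a<b with finite-bound (v ∘ suc) (v<b ∘ suc) a a<b
      ... | z , z<b , a≤z , v≤z with upperBound₂ z (v zero) z<b (v<b zero)
      ... | m , m<b , z≤m , v₀≤m = m , m<b , ≤-trans a≤z z≤m ,
        λ { zero → v₀≤m ; (suc i) → ≤-trans (v≤z i) z≤m }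

      module _ (S : Pred (Carrier γ) ℓ) (S-cofinal : ∀ v → v < b → ∃[ y ] (v < y × y < b × S y))
               {a : Carrier γ} (a<b : a < b) where

        -- Shelah's equivalence: if the types agree at z, they agree at every
        -- larger z, so there are only finitely many classes.
        Similar : Carrier γ → Carrier γ → Set ℓ
        Similar x y = ∃[ z ] (z < b × x ≤ z × y ≤ z × τ γ c x z ≡ τ γ c y z)

        Point : Set ℓ
        Point = Σ[ x ∈ Carrier γ ] (a < x × x < b × S x)

        Recurrent : Point → Set ℓ
        Recurrent (x , _) = ∀ v → v < b → ∃[ y ] (v < y × y < b × S y × Similar x y)

        isolated : ∀ p → ¬ Recurrent p →
                   ∃[ v ] (v < b × ∀ y → v < y → y < b → S y → ¬ Similar (proj₁ p) y)
        isolated p ¬rec with ¬∀⇒∃¬ ¬rec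
        ... | v , ¬p = v , byContradiction (λ v≮b → ¬p λ v<b → contradiction v<b v≮b) ,
          λ y v<y y<b y∈S x~y → ¬p λ _ → y , v<y , y<b , y∈S , x~y

        abstract
          -- Otherwise an infinite sequence could be chosen in which every point lies beyond all
          -- points similar to any earlier one, although there are at most `#types Q` classes.
          recurrent-point : ∃[ p ] Recurrent p
          recurrent-point = byContradiction λ none → contra (λ p → isolated p λ rec → none (p , rec))
            where
            module _ (iso : ∀ (p : Point) → ∃[ v ] (v < b × ∀ y → v < y → y < b → S y → ¬ Similar (proj₁ p) y)) where
              Later : Point → Point → Set ℓ
              Later p p′ = proj₁ p < proj₁ p′ × proj₁ (iso p) < proj₁ p′

              later : ∀ p → ∃[ p′ ] Later p p′
              later p@(x , a<x , x<b , _) with upperBound₂ x (proj₁ (iso p)) x<b (proj₁ (proj₂ (iso p)))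
              ... | m , m<b , x≤m , v≤m with S-cofinal m m<b
              ... | y , m<y , y<b , y∈S =
                (y , <-trans a<x (≤-<-trans x≤m m<y) , y<b , y∈S) , ≤-<-trans x≤m m<y , ≤-<-trans v≤m m<y

              first : Point
              first with S-cofinal a a<b
              ... | y , a<y , y<b , y∈S = y , a<y , y<b , y∈S

              module _ (point : ℕ → Point) (step : ∀ i → Later (point i) (point (suc i))) where
                x : ℕ → Carrier γ
                x i = proj₁ (point i)

                increasing : ∀ {i j} → i ℕ.≤′ j → x i ≤ x j
                increasing ℕ.≤′-refl           = ≤-refl
                increasing (ℕ.≤′-step {j} i≤j) = ≤-trans (increasing i≤j) (<⇒≤ (proj₁ (step j)))

                dissimilar : ∀ {i j} → i ℕ.< j → ¬ Similar (x i) (x j)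
                dissimilar {i} {j} i<j = proj₂ (proj₂ (iso (point i))) (x j)
                  (<-≤-trans (proj₂ (step i)) (increasing (ℕₚ.≤⇒≤′ i<j)))
                  (proj₁ (proj₂ (proj₂ (point j)))) (proj₂ (proj₂ (proj₂ (point j))))

                absurd : ∀ n → #types Q ℕ.< n → ¬ (x n < b)
                -- Seen from the common right end `x n`, two of more than `#types Q` points start
                -- intervals of equal type, and `x n` itself witnesses their similarity.
                absurd n N<n xₙ<b with pigeonhole N<n (λ i → τ γ c (x (toℕ i)) (x n))
                ... | i , j , i<j , eq = dissimilar i<j (x n , xₙ<b , below i , below j , eq)
                  where
                  below : ∀ (k : Fin n) → x (toℕ k) ≤ x n
                  below k = increasing (ℕₚ.≤⇒≤′ (ℕₚ.<⇒≤ (toℕ<n k)))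

            contra : ¬ (∀ (p : Point) → ∃[ v ] (v < b × ∀ y → v < y → y < b → S y → ¬ Similar (proj₁ p) y))
            contra iso with dependent-choice (first iso) (later iso)
            ... | point , _ , step =
              absurd iso point step _ ℕₚ.≤-refl (proj₁ (proj₂ (proj₂ (point (suc (#types Q))))))

        module _ {x : Carrier γ} (a<x : a < x) (x<b : x < b)
                 (rec : ∀ v → v < b → ∃[ y ] (v < y × y < b × S y × Similar x y)) where

          Often : Type Q → Set ℓ
          Often e = ∀ v → v < b → ∃[ y ] (v < y × y < b × S y × Similar x y × τ γ c x y ≡ e)

          Rarely : Type Q → Set ℓ
          Rarely e = ∃[ v ] (v < b × ∀ y → v < y → y < b → S y → Similar x y → ¬ (τ γ c x y ≡ e))

          rarely : ∀ {e} → ¬ Often e → Rarely e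
          rarely ¬often with ¬∀⇒∃¬ ¬often
          ... | v , ¬p = v , byContradiction (λ v≮b → ¬p λ v<b → contradiction v<b v≮b) ,
            λ y v<y y<b y∈S x~y eq → ¬p λ _ → y , v<y , y<b , y∈S , x~y , eq

          abstract
            -- If every one of the finitely many types died out, then beyond all their bounds the
            -- similar point supplied by `rec` would have no type left.
            often : ∃[ e ] Often e
            often = byContradiction λ none → contra λ e → rarely (λ o → none (e , o))
              where
              contra : ¬ (∀ e → Rarely e)
              contra rare with finite-bound (proj₁ ∘ rare) (proj₁ ∘ proj₂ ∘ rare) x x<b
              ... | z , z<b , _ , v≤z with rec z z<b
              ... | y , z<y , y<b , y∈S , x~y =
                proj₂ (proj₂ (rare (τ γ c x y))) y (≤-<-trans (v≤z _) z<y) y<b y∈S x~y refl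

          Selected : Type Q → Pred (Carrier γ) ℓ
          Selected e y = S y × x < y × Similar x y × τ γ c x y ≡ e

          selected-homogeneous : ∀ {e} → Often e → Homogeneous γ c b (Selected e) e
          selected-homogeneous {e} often = record { cofinal = cofinal ; eventually = eventually }
            where
            cofinal : ∀ v → v < b → ∃[ y ] (v < y × y < b × Selected e y)
            cofinal v v<b with upperBound₂ v x v<b x<b
            ... | m , m<b , v≤m , x≤m with often m m<b
            ... | y , m<y , y<b , y∈S , x~y , eq =
              y , ≤-<-trans v≤m m<y , y<b , y∈S , ≤-<-trans x≤m m<y , x~y , eq

            eventually : ∀ x′ → x′ < b → Selected e x′ →
                         ∃[ z ] (z < b × ∀ y → z < y → y < b → Selected e y → τ γ c x′ y ≡ e)
            -- From `z` on, `x` and `x′` see the same types, so `[x′, y)` inherits `e` from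
            -- `[x, y)`.
            eventually x′ _ (_ , _ , (z , z<b , x≤z , x′≤z , eq) , _) = z , z<b ,
              λ y z<y _ (_ , _ , _ , eq′) → trans
                (tp-interval-+ Q γ γ x′≤z (<⇒≤ z<y) x≤z (<⇒≤ z<y) (sym eq) refl) eq′

        abstract
          ramsey : ∃[ e ] Σ[ R ∈ Pred (Carrier γ) ℓ ] (Homogeneous γ c b R e × (∀ y → R y → a < y × S y))
          ramsey with recurrent-point
          ... | (x , a<x , x<b , x∈S) , rec with often a<x x<b rec
          ... | e , o = e , Selected a<x x<b rec e , selected-homogeneous a<x x<b rec o ,
            λ y (y∈S , x<y , _) → <-trans a<x x<y , y∈S

  -- Sums depend on types only, so one instance decides: three points `x < y < y′` of `R`, far
  -- enough apart that all three intervals between them have type `e`.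
  homogeneous-idempotent : ∀ (γ : Ordinal ℓ) {c b R e} → Homogeneous γ c b R e →
                           ∀ {x} → Ordinal._<_ γ x b → R x → Plus e e e
  homogeneous-idempotent γ {c} {b} {R} {e} H {x} x<b x∈R with H.beyond x x<b x∈R x x<b | H.eventually x x<b x∈R
    where module H = Homogeneous H
  ... | y , x<y , _ , y<b , y∈R , eq | z , z<b , hom with Homogeneous.beyond H y y<b y∈R z z<b
  ... | y′ , y<y′ , z<y′ , y′<b , y′∈R , eq′ =
    λ γ′ c′ a≤p p≤b eq₁ eq₂ → trans
      (plus γ (Order.<⇒≤ γ x<y) (Order.<⇒≤ γ y<y′) γ′ c′ a≤p p≤b (trans eq₁ (sym eq)) (trans eq₂ (sym eq′)))
      (hom y′ z<y′ y′<b y′∈R)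

  -- Removing `[x, y)`, of type `e`, leaves a tail that starts at another point of `R` and so has
  -- the same type as before.
  tail-absorbs : ∀ (γ : Ordinal ℓ) {c b R e} → Homogeneous γ c b R e →
                 ∀ {x} → Ordinal._<_ γ x b → R x → Plus e (τ γ c x b) (τ γ c x b)
  tail-absorbs γ {c} {b} {R} {e} H {x} x<b x∈R with Homogeneous.beyond H x x<b x∈R x x<b
  ... | y , x<y , _ , y<b , y∈R , eq =
    λ γ′ c′ a≤p p≤b eq₁ eq₂ → plus γ (Order.<⇒≤ γ x<y) (Order.<⇒≤ γ y<b) γ′ c′ a≤p p≤b
      (trans eq₁ (sym eq)) (trans eq₂ (sym (tail γ H x<b x∈R γ c b R H y y<b y∈R)))

  -- Realizing every type below `ω^ω`

  D : (γ : Ordinal ℓ) → ℕ → Pred (Carrier γ) ℓ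
  D γ = Multiple (Ordinal._<_ γ)

  D-pred : ∀ (γ : Ordinal ℓ) n {x} → D γ (suc n) x → D γ n x
  D-pred γ zero    _  = tt
  D-pred γ (suc n) Dx z z<x with Dx z z<x
  ... | y , z<y , y<x , Dy = y , z<y , y<x , D-pred γ n Dy

  D-≤ : ∀ (γ : Ordinal ℓ) {m n} → m ℕ.≤ n → ∀ {x} → D γ n x → D γ m x
  D-≤ γ = go ∘ ℕₚ.≤⇒≤′
    where
    go : ∀ {m n} → m ℕ.≤′ n → ∀ {x} → D γ n x → D γ m x
    go ℕ.≤′-refl           Dx = Dx
    go (ℕ.≤′-step {n} m≤n) Dx = go m≤n (D-pred γ n Dx)

  abstract
    patch : ∀ {A : Set ℓ} {i p} {I : Set i} (P : I → Pred A p) (c : I → A → Fin d) → (A → Fin d) →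
            (∀ {i j x} → P i x → P j x → i ≡ j) →
            Σ[ c′ ∈ (A → Fin d) ] (∀ i x → P i x → c′ x ≡ c i x)
    patch P c c₀ disjoint = (λ x → paint x (em _)) , λ i x x∈Pᵢ → paint-≡ i x x∈Pᵢ (em _)
      where
      paint : ∀ x → Dec (∃[ i ] P i x) → Fin d
      paint x (yes (i , _)) = c i x
      paint x (no _)        = c₀ x
      paint-≡ : ∀ i x → P i x → (∈? : Dec (∃[ i ] P i x)) → paint x ∈? ≡ c i x
      paint-≡ i x x∈Pᵢ (yes (j , x∈Pⱼ)) = cong (λ k → c k x) (disjoint x∈Pⱼ x∈Pᵢ)
      paint-≡ i x x∈Pᵢ (no none)        = contradiction (i , x∈Pᵢ) none

  module _ (γ : Ordinal ℓ) where
    open Order γ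

    τ-recolor : ∀ {c c′ : Coloring γ} {a b} → (∀ x → a ≤ x → x < b → c x ≡ c′ x) → τ γ c a b ≡ τ γ c′ a b
    τ-recolor c≗c′ = tp-cong Q γ (λ _ p → p) (λ _ p → p) (λ x (a≤x , x<b) → c≗c′ x a≤x x<b)

    glue : ∀ p (c c′ : Coloring γ) → Σ[ c″ ∈ Coloring γ ]
           ((∀ {a b} → b ≤ p → τ γ c″ a b ≡ τ γ c a b) × (∀ {a b} → p ≤ a → τ γ c″ a b ≡ τ γ c′ a b))
    glue p c c′ = (λ x → paint x (<-≤-connex x p)) ,
      (λ b≤p → τ-recolor λ x _ x<b → left x (<-≤-trans x<b b≤p) (<-≤-connex x p)) ,
      (λ p≤a → τ-recolor λ x a≤x _ → right x (≤-trans p≤a a≤x) (<-≤-connex x p))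
      where
      paint : ∀ x → x < p ⊎ p ≤ x → Fin d
      paint x (inj₁ _) = c x
      paint x (inj₂ _) = c′ x
      left : ∀ x → x < p → (s : x < p ⊎ p ≤ x) → paint x s ≡ c x
      left x x<p (inj₁ _)   = refl
      left x x<p (inj₂ p≤x) = contradiction x<p p≤x
      right : ∀ x → p ≤ x → (s : x < p ⊎ p ≤ x) → paint x s ≡ c′ x
      right x p≤x (inj₁ x<p) = contradiction x<p p≤x
      right x p≤x (inj₂ _)   = refl

  NonEmpty : Type Q → Set (lsuc ℓ)
  NonEmpty t = ∀ γ c {a b} → τ γ c a b ≡ t → Ordinal._<_ γ a b

  -- At positive rank a type records whether there is a point at all; at rank zero there is only one
  -- type.
  nonEmpty : ∀ (γ : Ordinal ℓ) {c a b} → Ordinal._<_ γ a b → NonEmpty (τ γ c a b)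
  nonEmpty γ {a = a} a<b γ′ c′ eq with tp-forth 0 γ γ′ (tp-≤ 0<Q γ γ′ (sym eq)) a (Order.≤-refl γ , a<b)
  ... | _ , match (a′≤x , x<b′) _ _ _ = Order.≤-<-trans γ′ a′≤x x<b′

  -- Every type turns out to be the type of some ordinal below ω^ω; in the
  -- absence of ordinal arithmetic, "below ω^n" means that the type is found
  -- on a proper initial segment of every multiple of ω^n.
  Prefix : ℕ → Type Q → Set (lsuc ℓ)
  Prefix n t = ∀ γ {a b} → let open Order γ in a < b → D γ n b →
               ∃[ p ] (a ≤ p × p < b × Σ[ c ∈ Coloring γ ] τ γ c a p ≡ t)

  prefix-≤ : ∀ {m n t} → m ℕ.≤ n → Prefix m t → Prefix n t
  prefix-≤ m≤n pre γ a<b Db = pre γ a<b (D-≤ γ m≤n Db)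

  -- The additive indecomposability of `ω^n`: the condition concerns only the end `b`, so what
  -- remains after the first summand qualifies again.
  prefix-+ : ∀ {n s t u} → Plus s t u → Prefix n s → Prefix n t → Prefix n u
  prefix-+ s+t≡u pre-s pre-t γ a<b Db with pre-s γ a<b Db
  ... | p , a≤p , p<b , c , eq with pre-t γ p<b Db
  ... | p′ , p≤p′ , p′<b , c′ , eq′ with glue γ p c c′
  ... | c″ , left , right = p′ , Order.≤-trans γ a≤p p≤p′ , p′<b , c″ ,
    s+t≡u γ c″ a≤p p≤p′ (trans (left (Order.≤-refl γ)) eq) (trans (right (Order.≤-refl γ)) eq′)

  prefix-empty : ∀ (γ : Ordinal ℓ) {c a} → Prefix 0 (τ γ c a a)
  prefix-empty γ {c} {a} γ′ {a′} a′<b′ _ = a′ , O′.≤-refl , a′<b′ , const (c a) ,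
    tp-empty Q γ′ γ (λ _ (a≤x , x<a) → a≤x x<a) (λ _ (a≤x , x<a) → a≤x x<a)
    where module O′ = Order γ′

  -- Exponent 1 makes `b′` a limit, which leaves room for the successor `p′` of `a′`.
  prefix-point : ∀ (γ : Ordinal ℓ) {c p b} → let open Order γ in
                 p < b → (∀ x → x < b → x ≤ p) → Prefix 1 (τ γ c p b)
  prefix-point γ {c} {p} {b} p<b max γ′ {a′} a′<b′ Db′ with Db′ a′ a′<b′
  ... | y , a′<y , y<b′ , _ with Order.least γ′ (Ordinal._<_ γ′ a′) (y , a′<y)
  ... | p′ , a′<p′ , p′-least =
    p′ , O′.<⇒≤ a′<p′ , O′.≤-<-trans (p′-least y a′<y) y<b′ , const (c p) , sym (tp-embeds Q constant)
    where
    module O = Order γ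
    module O′ = Order γ′
    constant : Embeds γ c (Interval γ p b) γ′ (const (c p)) (Interval γ′ a′ p′) (const a′)
    constant = record
      { into   = λ _ _ → O′.≤-refl , a′<p′
      ; onto   = λ y (a′≤y , y<p′) → p , (O.≤-refl , p<b) , O′.≤-antisym a′≤y (λ a′<y → p′-least y a′<y y<p′)
      ; mono   = λ x x′ (p≤x , _) (_ , x′<b) x<x′ → contradiction (O.≤-<-trans p≤x x<x′) (max x′ x′<b)
      ; colors = λ x (p≤x , x<b) → cong c (O.≤-antisym (max x x<b) p≤x)
      }

  module _ (γ : Ordinal ℓ) (x : ℕ → Carrier γ) (x-step : ∀ i → Ordinal._<_ γ (x i) (x (suc i))) where
    open Order γ

    increasing : ∀ {i j} → i ℕ.< j → x i < x j
    increasing = go ∘ ℕₚ.≤⇒≤′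
      where
      go : ∀ {i j} → i ℕ.<′ j → x i < x j
      go ℕ.≤′-refl           = x-step _
      go (ℕ.≤′-step {j} i<j) = <-trans (go i<j) (x-step j)

    increasing⁻¹ : ∀ {i j} → x i < x j → i ℕ.< j
    increasing⁻¹ {i} {j} xᵢ<xⱼ with ℕₚ.<-cmp i j
    ... | tri< i<j _ _  = i<j
    ... | tri≈ _ refl _ = contradiction xᵢ<xⱼ (<-irrefl refl)
    ... | tri> _ _ j<i  = contradiction (increasing j<i) (<-asym xᵢ<xⱼ)

    pieces-disjoint : ∀ {i j z} → Interval γ (x i) (x (suc i)) z → Interval γ (x j) (x (suc j)) z → i ≡ j
    pieces-disjoint (xᵢ≤z , z<xᵢ₊₁) (xⱼ≤z , z<xⱼ₊₁) = ℕₚ.≤-antisym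
      (ℕₚ.≤-pred (increasing⁻¹ (≤-<-trans xᵢ≤z z<xⱼ₊₁))) (ℕₚ.≤-pred (increasing⁻¹ (≤-<-trans xⱼ≤z z<xᵢ₊₁)))

    supremum : ∀ y → (∀ i → x i < y) →
               ∃[ p ] (p ≤ y × (∀ i → x i < p) × (∀ v → v < p → ∃[ i ] v < x i))
    supremum y below-y with least (λ p → ∀ i → x i < p) (y , below-y)
    ... | p , below-p , p-least = p , p-least y below-y , below-p , λ v v<p → byContradiction λ none →
      p-least v (λ i → <-≤-trans (x-step i) (λ v<xᵢ₊₁ → none (suc i , v<xᵢ₊₁))) v<p

    τ-steps : ∀ {c e} → Plus e e e → (∀ i → τ γ c (x i) (x (suc i)) ≡ e) →
              ∀ {i j} → i ℕ.< j → τ γ c (x i) (x j) ≡ e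
    τ-steps {c} {e} e+e≡e steps = go ∘ ℕₚ.≤⇒≤′
      where
      go : ∀ {i j} → i ℕ.<′ j → τ γ c (x i) (x j) ≡ e
      go ℕ.≤′-refl           = steps _
      go (ℕ.≤′-step {j} i<j) =
        e+e≡e γ c (<⇒≤ (increasing (ℕₚ.≤′⇒≤ i<j))) (<⇒≤ (x-step j)) (go i<j) (steps j)

    sequence-homogeneous : ∀ {c e p} → Plus e e e → (∀ i → τ γ c (x i) (x (suc i)) ≡ e) →
                           (∀ i → x i < p) → (∀ v → v < p → ∃[ i ] v < x i) →
                           Homogeneous γ c p (λ y → ∃[ i ] y ≡ x i) e
    sequence-homogeneous e+e≡e steps below-p cof = record
      { cofinal    = λ v v<p → let (i , v<xᵢ) = cof v v<p in x i , v<xᵢ , below-p i , i , refl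
      ; eventually = λ { _ _ (i , refl) → x i , below-p i ,
          λ { _ xᵢ<y _ (j , refl) → τ-steps e+e≡e steps (increasing⁻¹ xᵢ<y) } }
      }

  -- Copies of `e` are laid end to end below a multiple `y₀` of `ω^n`. Just `ω` of them are enough,
  -- because `Tail` ignores cofinality. Their supremum may be `y₀` itself; the next exponent keeps
  -- it strictly below `b`.
  prefix-tail : ∀ {n e r} → Plus e e e → NonEmpty e → Tail e r → Prefix n e → Prefix (suc n) r
  prefix-tail {n} {e} {r} e+e≡e e-nonEmpty tail-r pre γ {a} {b} a<b Db with Db a a<b
  ... | y₀ , a<y₀ , y₀<b , Dy₀ with dependent-choice (a , a<y₀) next
    where
    open Order γ
    Start : Set ℓ
    Start = ∃[ x ] x < y₀
    Next : Start → Start → Set ℓ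
    Next (x , _) (x′ , _) = x < x′ × Σ[ c ∈ Coloring γ ] τ γ c x x′ ≡ e
    next : ∀ p → ∃[ p′ ] Next p p′
    next (x , x<y₀) with pre γ x<y₀ Dy₀
    ... | p , x≤p , p<y₀ , c , eq = (p , p<y₀) , e-nonEmpty γ c eq , c , eq
  ... | point , refl , step with supremum γ (proj₁ ∘ point) (proj₁ ∘ step) y₀ (proj₂ ∘ point)
  ... | p , p≤y₀ , below-p , cof with patch (λ i → Interval γ (proj₁ (point i)) (proj₁ (point (suc i))))
                                        (λ i → proj₁ (proj₂ (step i))) (proj₁ (proj₂ (step 0)))
                                        (pieces-disjoint γ (proj₁ ∘ point) (proj₁ ∘ step))
  ... | c , c≗ = p , <⇒≤ (below-p 0) , ≤-<-trans p≤y₀ y₀<b , c ,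
    tail-r γ c p _ (sequence-homogeneous γ (proj₁ ∘ point) (proj₁ ∘ step) e+e≡e steps below-p cof)
      _ (below-p 0) (0 , refl)
    where
    open Order γ
    steps : ∀ i → τ γ c (proj₁ (point i)) (proj₁ (point (suc i))) ≡ e
    steps i = trans (τ-recolor γ (λ z xᵢ≤z z<xᵢ₊₁ → c≗ i z (xᵢ≤z , z<xᵢ₊₁))) (proj₂ (proj₂ (step i)))

  -- Induction on the end. At a limit of whatever cofinality the tail has type `e · ω`, where `e` is
  -- already the type of some `[x, y)` with `y < b` and falls under the induction hypothesis.
  prefix-exists : ∀ (γ : Ordinal ℓ) c a b → Order._≤_ γ a b → ∃[ n ] Prefix n (τ γ c a b)
  prefix-exists γ c a b a≤b = wf-induction P step b a a≤b
    where
    open Order γ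
    P : Carrier γ → Set (lsuc ℓ)
    P b = ∀ a → a ≤ b → ∃[ n ] Prefix n (τ γ c a b)

    combine-+ : ∀ {s t u} → Plus s t u → ∃[ m ] Prefix m s → ∃[ n ] Prefix n t → ∃[ k ] Prefix k u
    combine-+ s+t≡u (m , pre-s) (n , pre-t) = m ℕ.⊔ n ,
      prefix-+ s+t≡u (prefix-≤ (ℕₚ.m≤m⊔n m n) pre-s) (prefix-≤ (ℕₚ.m≤n⊔m m n) pre-t)

    step : ∀ b → (∀ y → y < b → P y) → P b
    step b IH a a≤b with ≤⇒<⊎≡ a≤b
    ... | inj₂ refl = 0 , prefix-empty γ
    ... | inj₁ a<b with em ℓ {∃[ p ] (p < b × ∀ x → x < b → x ≤ p)}
    ... | yes (p , p<b , max) =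
      combine-+ (plus γ (max a a<b) (<⇒≤ p<b)) (IH p p<b a (max a a<b)) (1 , prefix-point γ p<b max)
    ... | no limit with Ramsey.ramsey γ c (λ _ → ⊤) cofinal a<b
      where
      cofinal : ∀ v → v < b → ∃[ y ] (v < y × y < b × ⊤ {ℓ})
      cofinal v v<b = byContradiction λ none → limit (v , v<b , λ x x<b v<x → none (x , v<x , x<b , tt))
    ... | e , R , H , R⊆ with Homogeneous.cofinal H a a<b
    ... | x , a<x , x<b , x∈R with Homogeneous.beyond H x x<b x∈R x x<b
    ... | y , x<y , _ , y<b , y∈R , eq with IH y y<b x (<⇒≤ x<y)
    ... | n , pre-e = combine-+ (plus γ (<⇒≤ a<x) (<⇒≤ x<b)) (IH x x<b a (<⇒≤ a<x))
      (suc n , prefix-tail (homogeneous-idempotent γ H x<b x∈R) (subst NonEmpty eq (nonEmpty γ x<y))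
                           (tail γ H x<b x∈R) (subst (Prefix n) eq pre-e))

  finite-max : ∀ {k} (f : Fin k → ℕ) → ∃[ n ] (∀ i → f i ℕ.≤ n)
  finite-max {zero}  f = 0 , λ ()
  finite-max {suc k} f with finite-max (f ∘ suc)
  ... | n , f≤n = f zero ℕ.⊔ n ,
    λ { zero → ℕₚ.m≤m⊔n (f zero) n ; (suc i) → ℕₚ.≤-trans (f≤n i) (ℕₚ.m≤n⊔m (f zero) n) }

  abstract
    prefix-uniform : ∃[ n ] (∀ (γ : Ordinal ℓ) c {a b} → Order._≤_ γ a b → Prefix n (τ γ c a b))
    prefix-uniform = proj₁ bound , λ γ c {a} {b} a≤b → let (n , pre) = prefix-exists γ c a b a≤b in
      prefix-≤ (proj₂ bound (τ γ c a b)) (proj₂ (level (τ γ c a b)) n pre)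
      where
      level : ∀ t → ∃[ m ] (∀ n → Prefix n t → Prefix m t)
      level t with em (lsuc ℓ) {∃[ m ] Prefix m t}
      ... | yes (m , pre) = m , λ _ _ → pre
      -- A type without any exponent gets a default, about which nothing has to be shown.
      ... | no  none      = 0 , λ n pre → contradiction (n , pre) none
      bound : ∃[ n ] (∀ t → proj₁ (level t) ℕ.≤ n)
      bound = finite-max (λ t → proj₁ (level t))

  -- Stretching a type over all nonzero multiples of `ω^n`

  Flexible : ℕ → Type Q → Set (lsuc ℓ)
  Flexible n t = ∀ γ {a b} → Ordinal._<_ γ a b → D γ n b → Σ[ c ∈ Coloring γ ] τ γ c a b ≡ t

  -- Transfinite iteration of next from a up to b.
  module Tiling (γ : Ordinal ℓ) {a b : Carrier γ} (a<b : Ordinal._<_ γ a b)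
                (next : Carrier γ → Carrier γ)
                (x<next : ∀ {x} → Ordinal._<_ γ x b → Ordinal._<_ γ x (next x))
                (next<b : ∀ {x} → Ordinal._<_ γ x b → Ordinal._<_ γ (next x) b) where
    open Order γ

    -- An inductive predicate replaces a sequence indexed by ordinals: limit stages are recognized
    -- inside `γ` as the points at which earlier ends accumulate.
    data End : Carrier γ → Set ℓ where
      base : End a
      step : ∀ {x} → End x → x < b → End (next x)
      lim  : ∀ {y} → a < y → y < b → (∀ z → z < y → ∃[ x ] (z < x × x < y × End x)) → End y

    end<b : ∀ {x} → End x → x < b
    end<b base          = a<b
    end<b (step _ x<b)  = next<b x<b
    end<b (lim _ y<b _) = y<b

    a≤end : ∀ {x} → End x → a ≤ x
    a≤end base          = ≤-refl
    a≤end (step x∈ x<b) = <⇒≤ (≤-<-trans (a≤end x∈) (x<next x<b))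
    a≤end (lim a<y _ _) = <⇒≤ a<y

    next≤end : ∀ h → End h → ∀ g → End g → g < h → next g ≤ h
    next≤end = wf-induction _ go
      where
      go : ∀ h → (∀ k → k < h → End k → ∀ g → End g → g < k → next g ≤ k) →
           End h → ∀ g → End g → g < h → next g ≤ h
      go _ IH base g g∈ g<a = contradiction g<a (a≤end g∈)
      go _ IH (step {x} x∈ x<b) g g∈ g<h with compare g x
      ... | tri< g<x _ _  = ≤-trans (IH x (x<next x<b) x∈ g g∈ g<x) (<⇒≤ (x<next x<b))
      ... | tri≈ _ refl _ = ≤-refl
      ... | tri> _ _ x<g  = contradiction g<h (IH g g<h g∈ x x∈ x<g)
      go h IH (lim _ _ cof) g g∈ g<h with cof g g<h
      ... | y , g<y , y<h , y∈ = ≤-trans (IH y y<h y∈ g g∈ g<y) (<⇒≤ y<h)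

    -- If ends accumulate at `x`, then `x` is an end. Otherwise some `z < x` has no end strictly
    -- between it and `x`, and the tile around `z` must reach `x`, since its right end cannot fall
    -- into that gap.
    locate : ∀ x → a ≤ x → x < b → ∃[ g ] (End g × g ≤ x × x < next g)
    locate = wf-induction _ go
      where
      go : ∀ x → (∀ y → y < x → a ≤ y → y < b → ∃[ g ] (End g × g ≤ y × y < next g)) →
           a ≤ x → x < b → ∃[ g ] (End g × g ≤ x × x < next g)
      go x IH a≤x x<b with em ℓ {End x}
      ... | yes x∈ = x , x∈ , ≤-refl , x<next x<b
      ... | no  x∉ with ≤⇒<⊎≡ a≤x
      ... | inj₂ refl = contradiction base x∉
      ... | inj₁ a<x with em ℓ {∃[ z ] (z < x × ∀ y → z < y → y < x → ¬ End y)}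
      ... | no cofinal = contradiction
              (lim a<x x<b λ z z<x → byContradiction λ none →
                cofinal (z , z<x , λ y z<y y<x y∈ → none (y , z<y , y<x , y∈))) x∉
      ... | yes (z , z<x , gap) with <-≤-connex z a
      ... | inj₁ z<a = contradiction base (gap a z<a a<x)
      ... | inj₂ a≤z with IH z z<x a≤z (<-trans z<x x<b)
      ... | g , g∈ , g≤z , z<next with compare x (next g)
      ... | tri< x<next _ _ = g , g∈ , <⇒≤ (≤-<-trans g≤z z<x) , x<next
      ... | tri≈ _ refl _ = contradiction (step g∈ (end<b g∈)) x∉
      ... | tri> _ _ next<x = contradiction (step g∈ (end<b g∈)) (gap (next g) z<next next<x)

    Block : Carrier γ → Pred (Carrier γ) ℓ
    Block g x = End g × Interval γ g (next g) x

    block-disjoint : ∀ {g h x} → Block g x → Block h x → g ≡ h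
    block-disjoint {g} {h} (g∈ , g≤x , x<g′) (h∈ , h≤x , x<h′) with compare g h
    ... | tri< g<h _ _ = contradiction (<-≤-trans x<g′ (next≤end h h∈ g g∈ g<h)) h≤x
    ... | tri≈ _ g≡h _ = g≡h
    ... | tri> _ _ h<g = contradiction (<-≤-trans x<h′ (next≤end g g∈ h h∈ h<g)) g≤x

    module _ (mid : Carrier γ → Carrier γ)
             (x≤mid : ∀ {x} → x < b → x ≤ mid x) (mid<next : ∀ {x} → x < b → mid x < next x)
             {c : Coloring γ} {e z r : Type Q}
             (e+e≡e : Plus e e e) (r+z≡e : Plus r z e) (tail-r : Tail e r)
             (left : ∀ {g} → End g → τ γ c g (mid g) ≡ z)
             (right : ∀ {g} → End g → τ γ c (mid g) (next g) ≡ r) where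

      mid-mono : ∀ {g h} → End g → End h → g < h → mid g < mid h
      mid-mono g∈ h∈ g<h =
        <-≤-trans (mid<next (end<b g∈)) (≤-trans (next≤end _ h∈ _ g∈ g<h) (x≤mid (end<b h∈)))

      mid-cancel : ∀ {g h} → End g → End h → mid g < mid h → g < h
      mid-cancel {g} {h} g∈ h∈ mg<mh with compare g h
      ... | tri< g<h _ _  = g<h
      ... | tri≈ _ refl _ = contradiction mg<mh (<-irrefl refl)
      ... | tri> _ _ h<g  = contradiction (mid-mono h∈ g∈ h<g) (<-asym mg<mh)

      Mid : Carrier γ → Pred (Carrier γ) ℓ
      Mid y x = ∃[ k ] (End k × k < y × x ≡ mid k)

      mid-homogeneous : ∀ {y} → (∀ z → z < y → ∃[ x ] (z < x × x < y × End x)) →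
                        (∀ {k} → End k → k < y → mid k < y) →
                        (∀ {h} → End h → h < y → ∀ {g} → End g → g < h → τ γ c (mid g) (mid h) ≡ e) →
                        Homogeneous γ c y (Mid y) e
      mid-homogeneous cof mid<y hom = record
        { cofinal    = λ v v<y → let (k , v<k , k<y , k∈) = cof v v<y in
            mid k , <-≤-trans v<k (x≤mid (end<b k∈)) , mid<y k∈ k<y , k , k∈ , k<y , refl
        ; eventually = λ { _ _ (k , k∈ , k<y , refl) → mid k , mid<y k∈ k<y ,
            λ { _ mk<mh _ (h , h∈ , h<y , refl) → hom h∈ h<y k∈ (mid-cancel k∈ h∈ mk<mh) } }
        }

      -- Measuring between middles instead of ends unifies the two kinds of stages. The end `h` is
      -- preceded by `r` either way, after a successor step as the second half of a tile and at a
      -- limit as the tail `e · ω`; then `[h, mid h)` adds `z`, and `r + z = e`.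
      τ-mid : ∀ h → End h → ∀ g → End g → g < h → τ γ c (mid g) (mid h) ≡ e
      τ-mid = wf-induction _ go
        where
        go : ∀ h → (∀ k → k < h → End k → ∀ g → End g → g < k → τ γ c (mid g) (mid k) ≡ e) →
             End h → ∀ g → End g → g < h → τ γ c (mid g) (mid h) ≡ e
        go _ IH base g g∈ g<a = contradiction g<a (a≤end g∈)
        go h IH h∈@(step {x} x∈ x<b) g g∈ g<h = compose (compare g x)
          where
          last : τ γ c (mid x) (mid h) ≡ e
          last = r+z≡e γ c (<⇒≤ (mid<next x<b)) (x≤mid (end<b h∈)) (right x∈) (left h∈)
          compose : Tri (g < x) (g ≡ x) (x < g) → τ γ c (mid g) (mid h) ≡ e
          compose (tri≈ _ refl _) = last
          compose (tri> _ _ x<g)  = contradiction g<h (next≤end g g∈ x x∈ x<g)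
          compose (tri< g<x _ _)  = e+e≡e γ c (<⇒≤ (mid-mono g∈ x∈ g<x)) (<⇒≤ (mid-mono x∈ h∈ (x<next x<b)))
                                      (IH x (x<next x<b) x∈ g g∈ g<x) last
        go h IH h∈@(lim _ _ cof) g g∈ g<h =
          r+z≡e γ c (<⇒≤ (mid<h g∈ g<h)) (x≤mid (end<b h∈))
            (tail-r γ c h _ (mid-homogeneous cof mid<h (λ {k} k∈ k<h {g} → IH k k<h k∈ g))
              (mid g) (mid<h g∈ g<h) (g , g∈ , g<h , refl))
            (left h∈)
          where
          mid<h : ∀ {k} → End k → k < h → mid k < h
          mid<h k∈ k<h = <-≤-trans (mid<next (end<b k∈)) (next≤end h h∈ _ k∈ k<h)

      τ-mid-end : τ γ c (mid a) b ≡ r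
      τ-mid-end = tail-r γ c b _
        (mid-homogeneous cof (λ k∈ k<b → <-trans (mid<next k<b) (next<b k<b)) (λ {h} h∈ _ {g} → τ-mid h h∈ g))
        (mid a) (<-trans (mid<next a<b) (next<b a<b)) (a , base , a<b , refl)
        where
        cof : ∀ v → v < b → ∃[ x ] (v < x × x < b × End x)
        cof v v<b with upperBound₂ v a v<b a<b
        ... | w , w<b , v≤w , a≤w with locate w a≤w w<b
        ... | g , g∈ , _ , w<next = next g , ≤-<-trans v≤w w<next , next<b (end<b g∈) , step g∈ (end<b g∈)

  -- Put w = z + r. Then w · ω = z + (r + z) · ω = z + e · ω = w, hence any sum
  -- of copies of w has type w, and t = s + r = s + e + r = s + r + w stretches.
  module _ {n : ℕ} {e r z s t : Type Q}
           (pre-s : Prefix n s) (pre-r : Prefix n r) (pre-z : Prefix n z) (r-nonEmpty : NonEmpty r)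
           (e+e≡e : Plus e e e) (r+z≡e : Plus r z e) (e+r≡r : Plus e r r) (s+r≡t : Plus s r t)
           (tail-r : Tail e r) where

    module _ (γ : Ordinal ℓ) {b : Carrier γ} (Db : D γ n b) where
      open Order γ

      Tile : Carrier γ → Set ℓ
      Tile x = ∃[ m ] ∃[ y ] Σ[ c ∈ Coloring γ ]
                 (x ≤ m × m < y × y < b × τ γ c x m ≡ z × τ γ c m y ≡ r)

      tile : ∀ x → x < b → Tile x
      tile x x<b with pre-z γ x<b Db
      ... | m , x≤m , m<b , c , eq with pre-r γ m<b Db
      ... | y , m≤y , y<b , c′ , eq′ with glue γ m c c′
      ... | c″ , left , right =
        m , y , c″ , x≤m , r-nonEmpty γ c′ eq′ , y<b , trans (left ≤-refl) eq , trans (right ≤-refl) eq′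

      abstract
        tiles : Coloring γ → Σ[ mid ∈ (Carrier γ → Carrier γ) ] Σ[ next ∈ (Carrier γ → Carrier γ) ]
                Σ[ c ∈ (Carrier γ → Coloring γ) ] ∀ {x} → x < b →
                (x ≤ mid x × mid x < next x × next x < b ×
                 τ γ (c x) x (mid x) ≡ z × τ γ (c x) (mid x) (next x) ≡ r)
        tiles c₀ = (λ x → proj₁ (total x)) , (λ x → proj₁ (proj₂ (total x))) ,
                   (λ x → proj₁ (proj₂ (proj₂ (total x)))) , λ {x} → proj₂ (proj₂ (proj₂ (total x)))
          where
          total : ∀ x → ∃[ m ] ∃[ y ] Σ[ c ∈ Coloring γ ]
                    (x < b → x ≤ m × m < y × y < b × τ γ c x m ≡ z × τ γ c m y ≡ r)
          total x with x <? b
          -- `Tiling` expects total functions; away from `b` any values do.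
          ... | no  x≮b = x , x , c₀ , λ x<b → contradiction x<b x≮b
          ... | yes x<b with tile x x<b
          ... | m , y , c , props = m , y , c , λ _ → props

      fill : Coloring γ → ∀ {a} → a < b →
             Σ[ c ∈ Coloring γ ] ∃[ m ] (a ≤ m × m < b × τ γ c a m ≡ z × τ γ c m b ≡ r)
      fill c₀ {a} a<b with tiles c₀
      ... | mid , next , c , props with patch T.Block c c₀ T.block-disjoint
        where
        module T = Tiling γ a<b next
          (λ x<b → ≤-<-trans (proj₁ (props x<b)) (proj₁ (proj₂ (props x<b))))
          (λ x<b → proj₁ (proj₂ (proj₂ (props x<b))))
      ... | c′ , c′≗ = c′ , mid a , x≤mid a<b , <-trans (mid<next a<b) (next<b a<b) , left T.base ,
        T.τ-mid-end mid x≤mid mid<next e+e≡e r+z≡e tail-r left right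
        where
        x≤mid : ∀ {x} → x < b → x ≤ mid x
        x≤mid x<b = proj₁ (props x<b)
        mid<next : ∀ {x} → x < b → mid x < next x
        mid<next x<b = proj₁ (proj₂ (props x<b))
        next<b : ∀ {x} → x < b → next x < b
        next<b x<b = proj₁ (proj₂ (proj₂ (props x<b)))
        module T = Tiling γ a<b next (λ x<b → ≤-<-trans (x≤mid x<b) (mid<next x<b)) next<b
        left : ∀ {g} → T.End g → τ γ c′ g (mid g) ≡ z
        left {g} g∈ = trans
          (τ-recolor γ λ x g≤x x<m → c′≗ g x (g∈ , g≤x , <-trans x<m (mid<next (T.end<b g∈))))
          (proj₁ (proj₂ (proj₂ (proj₂ (props (T.end<b g∈))))))
        right : ∀ {g} → T.End g → τ γ c′ (mid g) (next g) ≡ r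
        right {g} g∈ = trans
          (τ-recolor γ λ x m≤x x<y → c′≗ g x (g∈ , ≤-trans (x≤mid (T.end<b g∈)) m≤x , x<y))
          (proj₂ (proj₂ (proj₂ (proj₂ (props (T.end<b g∈))))))

    flexible : Flexible n t
    flexible γ {a} {b} a<b Db with pre-s γ a<b Db
    ... | p , a≤p , p<b , c₁ , eq₁ with pre-r γ p<b Db
    ... | p′ , p≤p′ , p′<b , c₂ , eq₂ with fill γ Db c₂ p′<b
    ... | c₃ , m , p′≤m , m<b , eq₃ , eq₄ with glue γ p c₁ c₂
    ... | c₁₂ , left₁ , right₁ with glue γ p′ c₁₂ c₃
    -- The four pieces are read as `s + ((r + z) + r) = s + (e + r) = s + r = t`.
    ... | c , left , right = c ,
      s+r≡t γ c a≤p (<⇒≤ p<b)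
        (trans (left p≤p′) (trans (left₁ ≤-refl) eq₁))
        (e+r≡r γ c (≤-trans p≤p′ p′≤m) (<⇒≤ m<b)
          (r+z≡e γ c p≤p′ p′≤m
            (trans (left ≤-refl) (trans (right₁ ≤-refl) eq₂))
            (trans (right ≤-refl) eq₃))
          (trans (right p′≤m) eq₄))
      where open Order γ

  -- Nested Ramsey intervals

  module _ (γ : Ordinal ℓ) (c : Coloring γ) where
    open Order γ

    -- For e the type of [x, b′): e is idempotent and [x, b) has type e · ω.
    record RamseyLevel (a X b₀ : Carrier γ) : Set (lsuc ℓ) where
      field
        {x b b′}   : Carrier γ
        a<x        : a < x
        x≤X        : x ≤ X
        X<b′       : X < b′
        b′<b       : b′ < b
        b≤b₀       : b ≤ b₀
        idempotent : Plus (τ γ c x b′) (τ γ c x b′) (τ γ c x b′)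
        absorbs    : Plus (τ γ c x b′) (τ γ c x b) (τ γ c x b)
        tail-type  : Tail (τ γ c x b′) (τ γ c x b)

    open RamseyLevel

    Nested : ∀ {a X b₀ k} → (Fin k → RamseyLevel a X b₀) → Set ℓ
    Nested f = ∀ {i j} → i Fin.< j → b (f j) ≤ b′ (f i)

    -- Each further level is found inside the interval `[x₀, y)` of the one before. For this `y`
    -- must be a multiple of `ω^k`, and `ramsey` can choose it so: unfolded, `D γ (suc k) b₀` says
    -- that such points are cofinal in `b₀`. The point `X` comes from the innermost stage and
    -- therefore lies in `[x, b′)` for every level.
    nested-levels : ∀ k {a b₀} → a < b₀ → D γ k b₀ →
                    ∃[ X ] (a ≤ X × X < b₀ × Σ[ f ∈ (Fin k → RamseyLevel a X b₀) ] Nested f)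
    nested-levels zero    {a} a<b₀ _ = a , ≤-refl , a<b₀ , (λ ()) , λ { {()} }
    nested-levels (suc k) {a} {b₀} a<b₀ Db₀ with Ramsey.ramsey γ c (D γ k) Db₀ a<b₀
    ... | e , R , H , R⊆ with Homogeneous.cofinal H a a<b₀
    ... | x₀ , a<x₀ , x₀<b₀ , x₀∈R with Homogeneous.beyond H x₀ x₀<b₀ x₀∈R x₀ x₀<b₀
    ... | y , x₀<y , _ , y<b₀ , y∈R , eq with nested-levels k x₀<y (proj₂ (R⊆ y y∈R))
    ... | X , x₀≤X , X<y , f , nested = X , ≤-trans (<⇒≤ a<x₀) x₀≤X , <-trans X<y y<b₀ , g , g-nested
      where
      outer : RamseyLevel a X b₀
      outer = record
        { a<x = a<x₀ ; x≤X = x₀≤X ; X<b′ = X<y ; b′<b = y<b₀ ; b≤b₀ = ≤-refl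
        ; idempotent = subst (λ t → Plus t t t) (sym eq) (homogeneous-idempotent γ H x₀<b₀ x₀∈R)
        ; absorbs    = subst (λ t → Plus t (τ γ c x₀ b₀) (τ γ c x₀ b₀)) (sym eq) (tail-absorbs γ H x₀<b₀ x₀∈R)
        ; tail-type  = subst (λ t → Tail t (τ γ c x₀ b₀)) (sym eq) (tail γ H x₀<b₀ x₀∈R)
        }
      inner : RamseyLevel x₀ X y → RamseyLevel a X b₀
      inner l = record
        { a<x = <-trans a<x₀ (a<x l) ; x≤X = x≤X l ; X<b′ = X<b′ l ; b′<b = b′<b l
        ; b≤b₀ = ≤-trans (b≤b₀ l) (<⇒≤ y<b₀)
        ; idempotent = idempotent l ; absorbs = absorbs l ; tail-type = tail-type l
        }
      g : Fin (suc k) → RamseyLevel a X b₀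
      g zero    = outer
      g (suc i) = inner (f i)
      g-nested : Nested g
      g-nested {zero}  {suc j} _           = b≤b₀ (f j)
      g-nested {suc i} {suc j} (ℕ.s≤s i<j) = nested i<j

    -- By pigeonhole [X, b′ᵢ) and [X, b′ⱼ) have the same type for some i < j.
    -- Then so do [xⱼ, b′ᵢ) and [xⱼ, b′ⱼ), whence e = r + z for e, r and z the
    -- types of [xⱼ, b′ⱼ), [xⱼ, bⱼ) and [bⱼ, b′ᵢ).
    flexible-interval : ∀ {n} → (∀ {a b} → a ≤ b → Prefix n (τ γ c a b)) →
                        (∀ k x → ∃[ y ] (x < y × D γ k y)) →
                        ∀ p u → ∃[ y ] (p < y × u < y × Flexible n (τ γ c p y))
    flexible-interval prefix cofinal p u = start (<-≤-connex p u)
      where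
      result : ∀ {a} → p ≤ a → u ≤ a → ∃[ y ] (p < y × u < y × Flexible _ (τ γ c p y))
      result {a} p≤a u≤a with cofinal (suc (#types Q)) a
      ... | b₀ , a<b₀ , Db₀ with nested-levels (suc (#types Q)) a<b₀ Db₀
      ... | X , a≤X , X<b₀ , f , nested with pigeonhole (ℕₚ.n<1+n (#types Q)) (λ i → τ γ c X (b′ (f i)))
      ... | i , j , i<j , eq = b l , ≤-<-trans p≤a a<b , ≤-<-trans u≤a a<b ,
        flexible (prefix p≤x) (prefix x≤b) (prefix (nested i<j)) (nonEmpty γ x<b)
          (idempotent l) (subst (Plus _ _) e-eq (plus γ x≤b (nested i<j))) (absorbs l)
          (plus γ p≤x x≤b) (tail-type l)
        where
        l = f j
        x<b : x l < b l
        x<b = ≤-<-trans (x≤X l) (<-trans (X<b′ l) (b′<b l))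
        x≤b : x l ≤ b l
        x≤b = <⇒≤ x<b
        a<b : a < b l
        a<b = <-trans (a<x l) x<b
        p≤x : p ≤ x l
        p≤x = ≤-trans p≤a (<⇒≤ (a<x l))
        e-eq : τ γ c (x l) (b′ (f i)) ≡ τ γ c (x l) (b′ l)
        e-eq = tp-interval-+ Q γ γ (x≤X l) (<⇒≤ (X<b′ (f i))) (x≤X l) (<⇒≤ (X<b′ l)) refl eq
      start : p < u ⊎ u ≤ p → ∃[ y ] (p < y × u < y × Flexible _ (τ γ c p y))
      start (inj₁ p<u) = result (<⇒≤ p<u) ≤-refl
      start (inj₂ u≤p) = result ≤-refl u≤p

  -- Continuous cuts into `κ` intervals

  module _ (κ : Ordinal ℓ) (i : Carrier κ) where
    private
      module K = Order κ

    -- Proofs of `True` are unique, unlike those of `j < i`; so elements of the segment are equal as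
    -- soon as their first components are.
    Segment : Ordinal ℓ
    Segment = record
      { Carrier            = Σ[ j ∈ Carrier κ ] True (j K.<? i)
      ; _<_                = K._<_ on proj₁
      ; isStrictTotalOrder = isStrictTotalOrderᶜ record
          { isEquivalence = isEquivalence
          ; trans         = K.<-trans
          ; compare       = cmp
          }
      ; wellFounded        = On.wellFounded proj₁ (Ordinal.wellFounded κ)
      }
      where
      cmp : Trichotomous _≡_ (K._<_ on proj₁)
      cmp (j , p) (k , q) with K.compare j k
      ... | tri< j<k j≢k k≮j  = tri< j<k (j≢k ∘ cong proj₁) k≮j
      ... | tri≈ j≮k refl k≮j = tri≈ j≮k (cong (j ,_) (T-irrelevant p q)) k≮j
      ... | tri> j≮k j≢k k<j  = tri> j≮k (j≢k ∘ cong proj₁) k<j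

    -- A strictly increasing map from `κ` to itself moves no point down, but this one would move `i`
    -- below `i`.
    ⋠segment : ¬ (κ ≼ Segment)
    ⋠segment (h , mono , _) = K.wf-induction (λ x → ¬ (proj₁ (h x) K.< x))
      (λ x IH hx<x → IH (proj₁ (h x)) hx<x (mono hx<x)) i (toWitness (proj₂ (h i)))

  module Cuts (κ γ : Ordinal ℓ) (f : Carrier κ → Carrier γ)
              (minimal : ∀ δ → HasCofinalSubset γ δ → κ ≼ δ)
              {ℓ′} (N : Carrier γ → Carrier γ → Set ℓ′)
              (N-exists : ∀ p u → ∃[ y ] (Ordinal._<_ γ p y × Ordinal._<_ γ u y × N p y)) where
    open Order γ
    private
      module K = Order κ

    module _ (i : Carrier κ) (g : ∀ {j} → j K.< i → Carrier γ) where
      -- For the least index this is the supremum of nothing, the least element of `γ`, so the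
      -- intervals leave no initial part uncovered.
      Supremum : Carrier γ → Set ℓ
      Supremum s = (∀ {j} (j<i : j K.< i) → g j<i ≤ s) × (∀ x → (∀ {j} (j<i : j K.< i) → g j<i ≤ x) → s ≤ x)

      Cut : Carrier γ → Set _
      Cut y = ∃[ s ] (Supremum s × s < y × f i < y × N s y)

      -- Taking the least candidate makes the value independent of the witness produced by `em`;
      -- this gives `cut-ext`, on which the unfolding of the recursion depends. The default `f i`
      -- never occurs in the end, by `good`.
      cut′ : Dec (∃[ y ] Cut y) → Carrier γ
      cut′ (yes ∃y) = proj₁ (least Cut ∃y)
      cut′ (no _)   = f i

      cut : Carrier γ
      cut = cut′ (em _)

      cut-correct : ∃[ y ] Cut y → Cut cut
      cut-correct ∃y = go (em _)
        where
        go : (Cut? : Dec (∃[ y ] Cut y)) → Cut (cut′ Cut?)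
        go (yes ∃y) = proj₁ (proj₂ (least Cut ∃y))
        go (no ∄y)  = contradiction ∃y ∄y

    module _ (i : Carrier κ) {g g′ : ∀ {j} → j K.< i → Carrier γ}
             (g≗g′ : ∀ {j} (j<i : j K.< i) → g j<i ≡ g′ j<i) where
      Cut-resp : ∀ {y} → Cut i g y → Cut i g′ y
      Cut-resp (s , (upper , least-upper) , rest) = s ,
        ((λ j<i → subst (_≤ s) (g≗g′ j<i) (upper j<i)) ,
         (λ x g′≤x → least-upper x λ j<i → subst (_≤ x) (sym (g≗g′ j<i)) (g′≤x j<i))) , rest

    cut-ext : ∀ i {g g′ : ∀ {j} → j K.< i → Carrier γ} → (∀ {j} (j<i : j K.< i) → g j<i ≡ g′ j<i) →
              cut i g ≡ cut i g′
    cut-ext i {g} {g′} g≗g′ = go (em _) (em _)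
      where
      g′≗g : ∀ {j} (j<i : j K.< i) → g′ j<i ≡ g j<i
      g′≗g j<i = sym (g≗g′ j<i)
      go : ∀ Cut? Cut′? → cut′ i g Cut? ≡ cut′ i g′ Cut′?
      go (yes ∃y) (yes ∃y′) with least (Cut i g) ∃y | least (Cut i g′) ∃y′
      ... | y , cy , y-least | y′ , cy′ , y′-least =
        ≤-antisym (y-least y′ (Cut-resp i g′≗g cy′)) (y′-least y (Cut-resp i g≗g′ cy))
      go (yes (y , cy)) (no ∄y′) = contradiction (y , Cut-resp i g≗g′ cy) ∄y′
      go (no ∄y) (yes (y , cy))  = contradiction (y , Cut-resp i g′≗g cy) ∄y
      go (no _) (no _)           = refl

    module Fix = FixPoint (Ordinal.wellFounded κ) (λ _ → Carrier γ) cut cut-ext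

    abstract
      end : Carrier κ → Carrier γ
      end = All.wfRec (Ordinal.wellFounded κ) ℓ (λ _ → Carrier γ) cut

      end-unfold : ∀ i → end i ≡ cut i (λ {j} _ → end j)
      end-unfold i = Fix.unfold-wfRec

    Good : Carrier κ → Set _
    Good i = Cut i (λ {j} _ → end j) (end i)

    -- Ends unbounded before `i` would form a cofinal subset of order type `Segment κ i`,
    -- contradicting the minimality of `κ`.
    bounded : ∀ i → (∀ j → j K.< i → Good j) → ∃[ x ] (∀ j → j K.< i → end j ≤ x)
    bounded i IH = byContradiction λ unbounded → ⋠segment κ i (minimal (Segment κ i)
      ((λ (j , _) → end j) , (λ {j} {k} → mono {j} {k}) , cofinal unbounded))
      where
      mono : StrictlyIncreasing (Segment κ i) γ (end ∘ proj₁)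
      mono {j , _} {k , k<i} j<k with IH k (toWitness k<i)
      ... | s , (upper , _) , s<end , _ = ≤-<-trans (upper j<k) s<end
      cofinal : ¬ (∃[ x ] (∀ j → j K.< i → end j ≤ x)) →
                ∀ x → ∃[ p ] (x < end (proj₁ p) ⊎ x ≡ end (proj₁ p))
      cofinal unbounded x = byContradiction λ none → unbounded (x , λ j j<i x<endⱼ →
        none ((j , fromWitness j<i) , inj₁ x<endⱼ))

    good : ∀ i → Good i
    good = K.wf-induction Good λ i IH → subst (Cut i (λ {j} _ → end j)) (sym (end-unfold i))
      (cut-correct i _ (exists i (bounded i IH)))
      where
      exists : ∀ i → ∃[ x ] (∀ j → j K.< i → end j ≤ x) → ∃[ y ] Cut i (λ {j} _ → end j) y
      exists i bound with least (λ x → ∀ j → j K.< i → end j ≤ x) bound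
      ... | s , upper , s-least with N-exists s (f i)
      ... | y , s<y , fi<y , Nsy = y , s , ((λ {j} → upper j) , λ x below → s-least x λ j → below {j}) ,
        s<y , fi<y , Nsy

    abstract
      start : Carrier κ → Carrier γ
      start i = proj₁ (good i)

      start<end : ∀ i → start i < end i
      start<end i = proj₁ (proj₂ (proj₂ (good i)))

      f<end : ∀ i → f i < end i
      f<end i = proj₁ (proj₂ (proj₂ (proj₂ (good i))))

      N-cut : ∀ i → N (start i) (end i)
      N-cut i = proj₂ (proj₂ (proj₂ (proj₂ (good i))))

      end≤start : ∀ {i j} → j K.< i → end j ≤ start i
      end≤start {i} = proj₁ (proj₁ (proj₂ (good i)))

      start-least : ∀ {i x} → (∀ j → j K.< i → end j ≤ x) → start i ≤ x
      start-least {i} {x} below = proj₂ (proj₁ (proj₂ (good i))) x (λ {j} → below j)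

    module _ (f-cofinal : ∀ x → ∃[ i ] (x < f i ⊎ x ≡ f i)) where
      abstract
        index : ∀ x → ∃[ i ] (x < end i × ∀ j → x < end j → i K.≤ j)
        index x with f-cofinal x
        ... | i , inj₁ x<fi  = K.least (λ i → x < end i) (i , <-trans x<fi (f<end i))
        ... | i , inj₂ refl = K.least (λ i → x < end i) (i , f<end i)

      π : Carrier γ → Carrier κ
      π x = proj₁ (index x)

      π-fibred : Fibred κ γ π
      π-fibred {x} {y} πx<πy = <-≤-trans (proj₁ (proj₂ (index x)))
        (λ y<end → proj₂ (proj₂ (index y)) (π x) y<end πx<πy)

      π⇒interval : ∀ {i x} → π x ≡ i → Interval γ (start i) (end i) x
      π⇒interval {x = x} refl =
        start-least (λ j j<πx x<endⱼ → proj₂ (proj₂ (index x)) j x<endⱼ j<πx) , proj₁ (proj₂ (index x))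

      interval⇒π : ∀ {i x} → Interval γ (start i) (end i) x → π x ≡ i
      interval⇒π {i} {x} (start≤x , x<end) = K.≤-antisym (proj₂ (proj₂ (index x)) i x<end)
        (λ πx<i → start≤x (<-≤-trans (proj₁ (proj₂ (index x))) (end≤start πx<i)))

      τ-fibre : ∀ {c} i → tp Q γ c (Fibre κ γ π (λ _ → ⊤) i) ≡ τ γ c (start i) (end i)
      τ-fibre i = tp-cong Q γ (λ x (_ , πx≡i) → π⇒interval πx≡i)
        (λ x x∈ → tt , interval⇒π x∈) (λ _ _ → refl)

  -- Copying the coloring interval by interval

  abstract
    -- Equal cofinality lets the same index set `κ` serve for both ordinals, so that `tp-Σ` compares
    -- the intervals index by index.
    realize : ∀ (κ γ₁ γ₂ : Ordinal ℓ) → Cf γ₁ ≡ κ → Cf γ₂ ≡ κ →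
              MultiplesCofinal γ₁ → MultiplesCofinal γ₂ →
              ∀ c₁ → Σ[ c₂ ∈ Coloring γ₂ ] tp Q γ₁ c₁ (λ _ → ⊤) ≡ tp Q γ₂ c₂ (λ _ → ⊤)
    realize κ γ₁ γ₂ ((f₁ , _ , cofinal₁) , minimal₁) ((f₂ , _ , cofinal₂) , minimal₂) D₁ D₂ c₁ = c₂ ,
      tp-Σ κ Q γ₁ γ₂ (C₁.π cofinal₁) (C₂.π cofinal₂) (C₁.π-fibred cofinal₁) (C₂.π-fibred cofinal₂)
        (λ i → trans (C₁.τ-fibre cofinal₁ i)
          (trans (sym (trans (repaint i) (proj₂ (piece i)))) (sym (C₂.τ-fibre cofinal₂ i))))
      where
      n : ℕ
      n = proj₁ prefix-uniform

      D-above : ∀ p u → ∃[ y ] (Ordinal._<_ γ₂ p y × Ordinal._<_ γ₂ u y × D γ₂ n y)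
      D-above p u with Order.<-≤-connex γ₂ p u
      ... | inj₁ p<u = let (y , u<y , Dy) = D₂ n u in y , Order.<-trans γ₂ p<u u<y , u<y , Dy
      ... | inj₂ u≤p = let (y , p<y , Dy) = D₂ n p in y , p<y , Order.≤-<-trans γ₂ u≤p p<y , Dy

      module C₁ = Cuts κ γ₁ f₁ minimal₁ (λ p y → Flexible n (τ γ₁ c₁ p y))
                       (flexible-interval γ₁ c₁ (proj₂ prefix-uniform γ₁ c₁) D₁)
      module C₂ = Cuts κ γ₂ f₂ minimal₂ (λ _ y → D γ₂ n y) D-above

      piece : ∀ i → Σ[ c ∈ Coloring γ₂ ] τ γ₂ c (C₂.start i) (C₂.end i) ≡ τ γ₁ c₁ (C₁.start i) (C₁.end i)
      -- `Flexible` leaves the left end free, so it does not matter that `C₂.start i` is a supremum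
      -- over which there is no control.
      piece i = C₁.N-cut i γ₂ (C₂.start<end i) (C₂.N-cut i)

      c₂ : Coloring γ₂
      c₂ x = proj₁ (piece (C₂.π cofinal₂ x)) x

      repaint : ∀ i → τ γ₂ c₂ (C₂.start i) (C₂.end i) ≡ τ γ₂ (proj₁ (piece i)) (C₂.start i) (C₂.end i)
      repaint i = τ-recolor γ₂ λ x start≤x x<end →
        cong (λ j → proj₁ (piece j) x) (C₂.interval⇒π cofinal₂ (start≤x , x<end))

  transport-coloring : ∀ (κ γ₁ γ₂ : Ordinal ℓ) → Cf γ₁ ≡ κ → Cf γ₂ ≡ κ →
                       MultiplesCofinal γ₁ → MultiplesCofinal γ₂ → ∀ {q} → q ℕ.≤ Q →
                       ∀ (𝔄 : ColoredOrdinal d ℓ) → OfOrderType 𝔄 γ₁ →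
                       Σ[ 𝔅 ∈ ColoredOrdinal d ℓ ] (OfOrderType 𝔅 γ₂ × 𝔄 ≡[ q ] 𝔅)
  transport-coloring κ γ₁ γ₂ cf₁ cf₂ D₁ D₂ {q} q≤Q 𝔄 (f , iso) =
    let (c , eq) = realize κ γ₁ γ₂ cf₁ cf₂ D₁ D₂ (coloring 𝔄 ∘ f⁻¹)
    in colored γ₂ c , ≅-refl γ₂ , ≡type⇒≡[] q 𝔄 (colored γ₂ c) (tp-≤ q≤Q α γ₂ (trans (tp-embeds Q embeds) eq))
    where
    open IsOrderIsomorphism iso using (surjective; injective; mono)

    α = ColoredOrdinal.ordinal 𝔄

    f⁻¹ : Carrier γ₁ → Carrier α
    f⁻¹ y = proj₁ (surjective y)

    f-f⁻¹ : ∀ y → f (f⁻¹ y) ≡ y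
    f-f⁻¹ y = proj₂ (surjective y) refl

    embeds : Embeds α (coloring 𝔄) (λ _ → ⊤) γ₁ (coloring 𝔄 ∘ f⁻¹) (λ _ → ⊤) f
    embeds = record
      { into   = λ _ _ → tt
      ; onto   = λ y _ → f⁻¹ y , tt , f-f⁻¹ y
      ; mono   = λ _ _ _ _ → mono
      ; colors = λ x _ → cong (coloring 𝔄) (sym (injective (f-f⁻¹ (f x))))
      }

open import Data.Nat.Base using (_≤_)

theorem11 : Classical → ∀ {ℓ} (d : ℕ) → 1 ≤ d →
    (κ : Ordinal ℓ) → IsRegularCardinal κ →
    (γ₁ γ₂ : Ordinal ℓ) → γ₁ ≡ᴸᴼ ω^ω → γ₂ ≡ᴸᴼ ω^ω →
    Cf γ₁ ≡ κ → Cf γ₂ ≡ κ →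
    (q : ℕ) (𝔄 : ColoredOrdinal d ℓ) → OfOrderType 𝔄 γ₁ →
    Σ[ 𝔅 ∈ ColoredOrdinal d ℓ ] (OfOrderType 𝔅 γ₂ × 𝔄 ≡[ q ] 𝔅)
theorem11 em {ℓ} d _ κ _ γ₁ γ₂ γ₁≡ω^ω γ₂≡ω^ω cf₁ cf₂ q 𝔄 𝔄≅γ₁ =
  -- Rank `suc q` is positive even for `q = 0`, as needed to recognize nonempty intervals.
  AtRank.transport-coloring em ℓ d (suc q) (ℕ.s≤s ℕ.z≤n) κ γ₁ γ₂ cf₁ cf₂
    (multiplesCofinal-resp γ₁ ω^ω γ₁≡ω^ω ω^ω-multiplesCofinal) (multiplesCofinal-resp γ₂ ω^ω γ₂≡ω^ω ω^ω-multiplesCofinal)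
    (ℕₚ.n≤1+n q) 𝔄 𝔄≅γ₁
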